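{- Let $n\ge 1$. The map $\mathcal A$ (defined explicitly in the context) is a bijection from the set of Dyck paths of semilength $n$ onto the set of $n\times n$ alternating sign matrices which are determined by their X-rays.
   Context: An alternating sign matrix is a square matrix with entries in $\{0,1,-1\}$ such that the sum of each row and of each column is $1$, and the nonzero entries in each row and in each column alternate in sign. Matrix rows are numbered from top to bottom and columns from left to right, starting with $1$. For an $n\times n$ alternating sign matrix $A$, its (antidiagonal) X-ray is the vector $(x_1,\dots,x_{2n-1})$ with $x_k=\sum_{i+j=k+1}A_{i,j}$. An $n\times n$ alternating sign matrix $A$ is determined by its X-ray if no other $n\times n$ alternating sign matrix has the same X-ray as $A$. A Dyck path of semilength $n$ is drawn in an $n\times n$ square of cells, as a lattice path with unit east and south steps from the top left corner to the bottom right corner that never goes below the main diagonal. That is, it is a word with $n$ letters $E$ and $n$ letters $S$ such that every prefix contains at least as many $E$'s as $S$'s. A peak is an occurrence of an $E$ step immediately followed by an $S$ step; a valley is an occurrence of an $S$ step immediately followed by an $E$ step. The position of a peak or valley is the pair $(i,j)$, where $i$ is the number of $S$ steps and $j$ the number of $E$ steps up to and including the first of the two steps involved (so $i\le j$). The cell just south-west of this lattice point is the cell in row $i+1$ and column $j$ (and its mirror image in the main diagonal is the cell in row $j$ and column $i+1$). The map $\mathcal A$ sends a Dyck path $D$ of semilength $n$ to the following $n\times n$ matrix. For each peak of $D$ at position $(i,j)$, all cells $(a,b)$ with $a+b=i+j+1$ and $i+1\le a\le j$ (the cells on the antidiagonal between the peak and its mirror image in the main diagonal) are filled with $1$. For each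 valley of $D$ at position $(i,j)$, all cells $(a,b)$ with $a+b=i+j+1$ and $i+1\le a\le j$ are filled with $-1$ (there are none if $i=j$). All remaining cells are filled with $0$. -}

module Defs where

open import Algebra.Properties.Monoid.Sum using (sum)
open import Data.Bool.Base using (if_then_else_)
open import Data.Fin.Base using (Fin; toℕ)
open import Data.Integer.Base using (ℤ; 0ℤ; 1ℤ; -1ℤ; sign)
import Data.Integer.Properties as ℤ
open import Data.List.Base using (List; []; _∷_; filter; length; take)
open import Data.List.Relation.Unary.Any using (any?)
open import Data.List.Relation.Unary.Linked using (Linked)
open import Data.Nat.Base using (ℕ; suc; _+_; _*_; _∸_; _≤_)
import Data.Nat.Properties as ℕ
open import Data.Product.Base using (Σ; _×_; _,_; proj₁)
open import Data.Sign.Base using (opposite)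
open import Data.Sum.Base using (_⊎_)
open import Data.Vec.Functional using (Vector; toList)
open import Function.Base using (_on_)
open import Level using (0ℓ)
open import Relation.Binary.Core using (Rel)
open import Relation.Binary.Definitions using (DecidableEquality)
open import Relation.Binary.PropositionalEquality using (_≡_; refl; _≗_)
open import Relation.Nullary.Decidable using (Dec; yes; no; does; ¬?; _×-dec_)

Matrix : ℕ → Set
Matrix n = Fin n → Fin n → ℤ

infix 4 _≋_

_≋_ : ∀ {n} → Rel (Matrix n) 0ℓ
A ≋ B = ∀ r c → A r c ≡ B r c

∑ : ∀ {n} → Vector ℤ n → ℤ
∑ = sum ℤ.+-0-monoid

-- Rows, columns and X-ray entries are numbered from 1.
num : ∀ {n} → Fin n → ℕ
num r = suc (toℕ r)

nonzeros : List ℤ → List ℤ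
nonzeros = filter (λ x → ¬? (x ℤ.≟ 0ℤ))

Alternating : ∀ {n} → Vector ℤ n → Set
Alternating v = Linked (λ x y → sign y ≡ opposite (sign x)) (nonzeros (toList v))

record IsASM {n} (A : Matrix n) : Set where
  field
    entries         : ∀ r c → A r c ≡ 0ℤ ⊎ A r c ≡ 1ℤ ⊎ A r c ≡ -1ℤ
    row-sum         : ∀ r → ∑ (λ c → A r c) ≡ 1ℤ
    col-sum         : ∀ c → ∑ (λ r → A r c) ≡ 1ℤ
    row-alternating : ∀ r → Alternating (λ c → A r c)
    col-alternating : ∀ c → Alternating (λ r → A r c)

xray : ∀ {n} → Matrix n → Vector ℤ (2 * n ∸ 1)
xray A k = ∑ λ i → ∑ λ j →
  if does (num i + num j ℕ.≟ num k + 1) then A i j else 0ℤ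

DeterminedByXray : ∀ {n} → Matrix n → Set
DeterminedByXray {n} A = (B : Matrix n) → IsASM B → xray B ≗ xray A → B ≋ A

DeterminedASM : ℕ → Set
DeterminedASM n = Σ (Matrix n) λ A → IsASM A × DeterminedByXray A

_≈ᴬ_ : ∀ {n} → Rel (DeterminedASM n) 0ℓ
_≈ᴬ_ = _≋_ on proj₁

data Step : Set where
  E S : Step

_≟ˢ_ : DecidableEquality Step
E ≟ˢ E = yes refl
E ≟ˢ S = no λ ()
S ≟ˢ E = no λ ()
S ≟ˢ S = yes refl

count : Step → List Step → ℕ
count s w = length (filter (s ≟ˢ_) w)

record DyckPath (n : ℕ) : Set where
  field
    word     : List Step
    count-E  : count E word ≡ n
    count-S  : count S word ≡ n
    prefixes : ∀ k → count S (take k word) ≤ count E (take k word)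

open DyckPath public

-- Two Dyck paths are equal when their words are; the proof fields are ignored.
_≈ᴰ_ : ∀ {n} → Rel (DyckPath n) 0ℓ
_≈ᴰ_ = _≡_ on word

-- In peaksFrom i j w and valleysFrom i j w, the word w is preceded by
-- i steps S and j steps E.
peaksFrom : ℕ → ℕ → List Step → List (ℕ × ℕ)
peaksFrom i j []          = []
peaksFrom i j (E ∷ S ∷ w) = (i , suc j) ∷ peaksFrom i (suc j) (S ∷ w)
peaksFrom i j (E ∷ w)     = peaksFrom i (suc j) w
peaksFrom i j (S ∷ w)     = peaksFrom (suc i) j w

valleysFrom : ℕ → ℕ → List Step → List (ℕ × ℕ)
valleysFrom i j []          = []
valleysFrom i j (S ∷ E ∷ w) = (suc i , j) ∷ valleysFrom (suc i) j (E ∷ w)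
valleysFrom i j (S ∷ w)     = valleysFrom (suc i) j w
valleysFrom i j (E ∷ w)     = valleysFrom i (suc j) w

peaks valleys : List Step → List (ℕ × ℕ)
peaks   = peaksFrom 0 0
valleys = valleysFrom 0 0

-- Cell (a , b) lies on the antidiagonal segment between a peak or valley
-- at position (i , j) and its mirror image in the main diagonal.
Between : ℕ → ℕ → ℕ × ℕ → Set
Between a b (i , j) = a + b ≡ i + j + 1 × i + 1 ≤ a × a ≤ j

between? : ∀ a b p → Dec (Between a b p)
between? a b (i , j) = (a + b ℕ.≟ i + j + 1) ×-dec (i + 1 ℕ.≤? a) ×-dec (a ℕ.≤? j)

-- A position (i , j) satisfies i + j = number of steps read so far, so
-- distinct peaks and valleys have disjoint segments, and testing peaks
-- before valleys is immaterial.
𝒜 : ∀ {n} → DyckPath n → Matrix n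
𝒜 D r c =
  if does (any? (between? (num r) (num c)) (peaks (word D))) then 1ℤ else
  if does (any? (between? (num r) (num c)) (valleys (word D))) then -1ℤ else
  0ℤ

module Submission where

-- A matrix is encoded by its corner sums C a b (first a rows, first b columns):
-- alternating sign matrices correspond to functions C that grow by 0 or 1 in
-- both directions and have the right boundary values. The X-ray is the second
-- difference of the sums of C over antidiagonals, so X-rays carry the same
-- information as these sums.
--
-- For a Dyck path with f t steps S among its first t steps, the corner sums of
-- 𝒜 D are a ⊓ b ⊓ f (a + b). If another C has the same antidiagonal sums, then
-- it agrees with them on one antidiagonal after the other: after a step E these
-- are the least possible values of C, after a step S the greatest.
--
-- Conversely let C come from a matrix determined by its X-ray. Transposition
-- preserves the X-ray, so C is symmetric. Translating C along the antidiagonals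
-- by one cell, except where C a b ≡ a ⊓ b, then gives corner sums with the same
-- antidiagonal sums (cells pair up by the reflection (a , b) ↦ (b + 1 , a − 1)),
-- so this translation does not change C. Hence C is constant on each
-- antidiagonal up to the truncation by a ⊓ b, and the constants form the
-- heights of a Dyck path.

open import Defs
open import Algebra.Properties.AbelianGroup using (∙-cancelˡ)
import Algebra.Properties.CommutativeSemigroup as CommutativeSemigroup
open import Algebra.Properties.Monoid.Sum using (sum-cong-≗; sum-replicate-zero)
open import Data.Bool.Base using (Bool; true; false; _∨_; if_then_else_)
open import Data.Fin.Base using (Fin; toℕ; fromℕ<)
open import Data.Fin.Properties using (toℕ<n; toℕ-fromℕ<; fromℕ<-toℕ)
open import Data.Integer.Base as ℤ using (ℤ; 0ℤ; 1ℤ; -1ℤ; +_; sign; ∣_∣)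
  renaming (_+_ to _+ᶻ_; _-_ to _-ᶻ_)
import Data.Integer.Properties as ℤ
open import Data.Integer.Tactic.RingSolver using (solve-∀)
open import Data.List.Base using (List; []; _∷_; length; take)
open import Data.List.Properties using (tabulate-cong)
open import Data.List.Relation.Unary.Any using (any?)
open import Data.List.Relation.Unary.Linked as Linked using (Linked; []; [-]; _∷_)
open import Data.Nat.Base
open import Data.Nat.Properties
open import Data.Product.Base using (Σ; _×_; _,_; proj₁; proj₂)
open import Data.Sign.Base using (opposite)
open import Data.Sum.Base as Sum using (_⊎_; inj₁; inj₂)
open import Data.Vec.Functional using (toList)
open import Function.Base using (_∘_; flip)
open import Function.Structures using (IsBijection)
open import Relation.Binary.Definitions using (tri<; tri≈; tri>)
open import Relation.Binary.PropositionalEquality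
open import Relation.Nullary.Decidable using (yes; no; does; dec-true; dec-false)
open import Relation.Nullary.Negation using (¬_; contradiction)

-- Alternating vectors and their partial sums

Bit : ℤ → Set
Bit x = x ≡ 0ℤ ⊎ x ≡ 1ℤ

Ternary : ℤ → Set
Ternary x = x ≡ 0ℤ ⊎ x ≡ 1ℤ ⊎ x ≡ -1ℤ

Opposed : ℤ → ℤ → Set
Opposed x y = sign y ≡ opposite (sign x)

-- Rows are restrictions of functions on `ℕ`, so that prefixes of every length and tails `g ∘ suc`
-- can be formed without conversions between finite types.
segment : (n : ℕ) → (ℕ → ℤ) → Fin n → ℤ
segment n g j = g (toℕ j)

prefix : ℕ → (ℕ → ℤ) → ℤ
prefix n g = ∑ (segment n g)

prefix-suc : ∀ n g → prefix (suc n) g ≡ prefix n g +ᶻ g n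
prefix-suc zero    g = ℤ.+-comm (g 0) 0ℤ
prefix-suc (suc n) g = begin
  g 0 +ᶻ prefix (suc n) (g ∘ suc)        ≡⟨ cong (g 0 +ᶻ_) (prefix-suc n (g ∘ suc)) ⟩
  g 0 +ᶻ (prefix n (g ∘ suc) +ᶻ g (suc n)) ≡⟨ ℤ.+-assoc (g 0) _ _ ⟨
  prefix (suc n) g +ᶻ g (suc n)          ∎
  where open ≡-Reasoning

nonzeros-0 : ∀ {x} xs → x ≡ 0ℤ → nonzeros (x ∷ xs) ≡ nonzeros xs
nonzeros-0 xs refl = refl

nonzeros-1 : ∀ {x} xs → x ≡ 1ℤ → nonzeros (x ∷ xs) ≡ 1ℤ ∷ nonzeros xs
nonzeros-1 xs refl = refl

nonzeros-−1 : ∀ {x} xs → x ≡ -1ℤ → nonzeros (x ∷ xs) ≡ -1ℤ ∷ nonzeros xs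
nonzeros-−1 xs refl = refl

shift⁰ : ∀ {x} y → x ≡ 0ℤ → x +ᶻ y ≡ y
shift⁰ y refl = ℤ.+-identityˡ y

-- A nonzero entry −1 (resp. 1) is imagined in front of the segment; the
-- partial sums are then offset by 0 (resp. 1).
bits⁻ : ∀ n {g} → (∀ j → Ternary (g j)) → Linked Opposed (-1ℤ ∷ nonzeros (toList (segment n g))) →
        ∀ b → b ≤ n → Bit (prefix b g)
bits⁺ : ∀ n {g} → (∀ j → Ternary (g j)) → Linked Opposed (1ℤ ∷ nonzeros (toList (segment n g))) →
        ∀ b → b ≤ n → Bit (1ℤ +ᶻ prefix b g)

bits⁻ n tern alt zero b≤n = inj₁ refl
bits⁻ (suc n) {g} tern alt (suc b) (s≤s b≤n) with tern 0
... | inj₁ g0 rewrite nonzeros-0 (toList (segment n (g ∘ suc))) g0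
                     | shift⁰ (prefix b (g ∘ suc)) g0 =
  bits⁻ n (tern ∘ suc) alt b b≤n
... | inj₂ (inj₁ g0) rewrite nonzeros-1 (toList (segment n (g ∘ suc))) g0 | g0 =
  bits⁺ n (tern ∘ suc) (Linked.tail alt) b b≤n
... | inj₂ (inj₂ g0) rewrite nonzeros-−1 (toList (segment n (g ∘ suc))) g0 with Linked.head alt
... | ()

bits⁺ n tern alt zero b≤n = inj₂ refl
bits⁺ (suc n) {g} tern alt (suc b) (s≤s b≤n) with tern 0
... | inj₁ g0 rewrite nonzeros-0 (toList (segment n (g ∘ suc))) g0
                     | shift⁰ (prefix b (g ∘ suc)) g0 =
  bits⁺ n (tern ∘ suc) alt b b≤n
... | inj₂ (inj₂ g0) rewrite nonzeros-−1 (toList (segment n (g ∘ suc))) g0 | g0 =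
  subst Bit (trans (sym (ℤ.+-identityˡ (prefix b (g ∘ suc))))
      (ℤ.+-assoc 1ℤ -1ℤ (prefix b (g ∘ suc)))) (bits⁻ n (tern ∘ suc) (Linked.tail alt) b b≤n)
... | inj₂ (inj₁ g0) rewrite nonzeros-1 (toList (segment n (g ∘ suc))) g0 with Linked.head alt
... | ()

-- The sign put in front is opposite to that of the first nonzero entry; if there is none, either
-- sign would do.
Linked-opposed-∷ : ∀ {xs} → Linked Opposed (nonzeros xs) →
                   Linked Opposed (1ℤ ∷ nonzeros xs) ⊎ Linked Opposed (-1ℤ ∷ nonzeros xs)
Linked-opposed-∷ {xs} alt with nonzeros xs
... | [] = inj₁ [-]
... | + n ∷ _ = inj₂ (refl ∷ alt)
... | ℤ.-[1+ n ] ∷ _ = inj₁ (refl ∷ alt)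

alternating⇒bits : ∀ n {g} → (∀ j → Ternary (g j)) → Alternating (segment n g) → prefix n g ≡ 1ℤ →
  ∀ b → b ≤ n → Bit (prefix b g)
alternating⇒bits n {g} tern alt total with Linked-opposed-∷ {toList (segment n g)} alt
... | inj₂ alt⁻ = bits⁻ n tern alt⁻
-- An imagined 1 in front would offset the total from 1 to 2, which is not a bit.
... | inj₁ alt⁺ with bits⁺ n tern alt⁺ n ≤-refl
... | bit rewrite total with bit
... | inj₁ ()
... | inj₂ ()

-- Given the offset, the partial sum of length 1 reveals the first entry. A nonzero first entry
-- takes the place of the imagined one and changes the offset for the rest.
linked⁻ : ∀ n g → (∀ b → Bit (prefix b g)) →
          Linked Opposed (-1ℤ ∷ nonzeros (toList (segment n g)))
linked⁺ : ∀ n g → (∀ b → Bit (1ℤ +ᶻ prefix b g)) →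
          Linked Opposed (1ℤ ∷ nonzeros (toList (segment n g)))

linked⁻ zero    g bits = [-]
linked⁻ (suc n) g bits with bits 1
... | inj₁ p = subst (λ l → Linked Opposed (-1ℤ ∷ l)) (sym (nonzeros-0 _ g0))
  (linked⁻ n (g ∘ suc) λ b → subst Bit (shift⁰ (prefix b (g ∘ suc)) g0) (bits (suc b)))
  where
  g0 : g 0 ≡ 0ℤ
  g0 = trans (sym (ℤ.+-identityʳ (g 0))) p
... | inj₂ p = subst (λ l → Linked Opposed (-1ℤ ∷ l)) (sym (nonzeros-1 _ g0))
  (refl ∷ linked⁺ n (g ∘ suc) λ b →
    subst (λ x → Bit (x +ᶻ prefix b (g ∘ suc))) g0 (bits (suc b)))
  where
  g0 : g 0 ≡ 1ℤ
  g0 = trans (sym (ℤ.+-identityʳ (g 0))) p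

linked⁺ zero    g bits = [-]
linked⁺ (suc n) g bits with bits 1
... | inj₁ p = subst (λ l → Linked Opposed (1ℤ ∷ l)) (sym (nonzeros-−1 _ g0))
  (refl ∷ linked⁻ n (g ∘ suc) λ b → subst Bit (cancel b) (bits (suc b)))
  where
  g0 : g 0 ≡ -1ℤ
  g0 = ∙-cancelˡ ℤ.+-0-abelianGroup 1ℤ _ _ (trans (cong (1ℤ +ᶻ_) (sym (ℤ.+-identityʳ (g 0)))) p)
  cancel : ∀ b → 1ℤ +ᶻ prefix (suc b) g ≡ prefix b (g ∘ suc)
  cancel b = trans (sym (ℤ.+-assoc 1ℤ (g 0) (prefix b (g ∘ suc)))) (shift⁰ _ (cong (1ℤ +ᶻ_) g0))
... | inj₂ p = subst (λ l → Linked Opposed (1ℤ ∷ l)) (sym (nonzeros-0 _ g0))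
  (linked⁺ n (g ∘ suc) λ b →
    subst (λ x → Bit (1ℤ +ᶻ x)) (shift⁰ (prefix b (g ∘ suc)) g0) (bits (suc b)))
  where
  g0 : g 0 ≡ 0ℤ
  g0 = ∙-cancelˡ ℤ.+-0-abelianGroup 1ℤ _ _ (trans (cong (1ℤ +ᶻ_) (sym (ℤ.+-identityʳ (g 0)))) p)

bits⇒alternating : ∀ n g → (∀ b → Bit (prefix b g)) → Alternating (segment n g)
bits⇒alternating n g bits = Linked.tail (linked⁻ n g bits)

∑-cong : ∀ {n} {v w : Fin n → ℤ} → v ≗ w → ∑ v ≡ ∑ w
∑-cong = sum-cong-≗ ℤ.+-0-monoid

Alternating-resp-≗ : ∀ {n} {v w : Fin n → ℤ} → v ≗ w → Alternating v → Alternating w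
Alternating-resp-≗ v≗w = subst (Linked Opposed ∘ nonzeros) (tabulate-cong v≗w)

IsASM-resp-≋ : ∀ {n} {A B : Matrix n} → A ≋ B → IsASM A → IsASM B
IsASM-resp-≋ A≋B asm = record
  { entries         = λ r c → subst Ternary (A≋B r c) (entries r c)
  ; row-sum         = λ r → trans (∑-cong λ c → sym (A≋B r c)) (row-sum r)
  ; col-sum         = λ c → trans (∑-cong λ r → sym (A≋B r c)) (col-sum c)
  ; row-alternating = λ r → Alternating-resp-≗ (A≋B r) (row-alternating r)
  ; col-alternating = λ c → Alternating-resp-≗ (λ r → A≋B r c) (col-alternating c)
  }
  where open IsASM asm

IsASM-flip : ∀ {n} {A : Matrix n} → IsASM A → IsASM (flip A)
IsASM-flip asm = record
  { entries         = flip entries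
  ; row-sum         = col-sum
  ; col-sum         = row-sum
  ; row-alternating = col-alternating
  ; col-alternating = row-alternating
  }
  where open IsASM asm

xray-cong : ∀ {n} {A B : Matrix n} → A ≋ B → xray A ≗ xray B
xray-cong A≋B k = ∑-cong λ i → ∑-cong λ j →
  cong (λ x → if does (num i + num j ≟ num k + 1) then x else 0ℤ) (A≋B i j)

-- Alternating sign matrices and their corner sums

Inc : ℕ → ℕ → Set
Inc m k = k ≡ m ⊎ k ≡ suc m

-- C a b is meant to be the sum of the entries in the first a rows and the first
-- b columns of a matrix that is continued by the identity outside the square.
record Profile (n : ℕ) (C : ℕ → ℕ → ℕ) : Set where
  field
    top   : ∀ b → C 0 b ≡ 0
    left  : ∀ a → C a 0 ≡ 0
    right : ∀ a b → Inc (C a b) (C a (suc b))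
    down  : ∀ a b → Inc (C a b) (C (suc a) b)
    rim   : ∀ a b → n ≤ a ⊎ n ≤ b → C a b ≡ a ⊓ b

Profile-flip : ∀ {n C} → Profile n C → Profile n (flip C)
Profile-flip pr = record
  { top   = left
  ; left  = top
  ; right = flip down
  ; down  = flip right
  ; rim   = λ a b out → trans (rim b a (Sum.swap out)) (⊓-comm b a)
  }
  where open Profile pr

-- For corner sums this is the matrix entry in row i and column j, counted from 0. The grouping lets
-- sums along a row telescope; columns are treated by transposition.
∂ : (ℕ → ℕ → ℕ) → ℕ → ℕ → ℤ
∂ C i j = (+ C (suc i) (suc j) -ᶻ + C i (suc j)) -ᶻ (+ C (suc i) j -ᶻ + C i j)

∂-flip : ∀ C i j → ∂ (flip C) j i ≡ ∂ C i j
∂-flip C i j = rearrange (+ C (suc i) (suc j)) (+ C (suc i) j) (+ C i (suc j)) (+ C i j)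
  where
  rearrange : ∀ x y z w → (x -ᶻ y) -ᶻ (z -ᶻ w) ≡ (x -ᶻ z) -ᶻ (y -ᶻ w)
  rearrange = solve-∀

restrict : ∀ n → (ℕ → ℕ → ℤ) → Matrix n
restrict n g r c = g (toℕ r) (toℕ c)

prefix-telescope : ∀ n (h : ℕ → ℤ) → prefix n (λ j → h (suc j) -ᶻ h j) ≡ h n -ᶻ h 0
prefix-telescope zero    h = sym (ℤ.+-inverseʳ (h 0))
prefix-telescope (suc n) h =
  trans (cong (h 1 -ᶻ h 0 +ᶻ_) (prefix-telescope n (h ∘ suc))) (collapse (h 1) (h 0) (h (suc n)))
  where
  collapse : ∀ x y z → (x -ᶻ y) +ᶻ (z -ᶻ x) ≡ z -ᶻ y
  collapse = solve-∀

suc-⊖ : ∀ m → + suc m -ᶻ + m ≡ 1ℤ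
suc-⊖ m = trans (cong (_-ᶻ + m) (ℤ.pos-+ 1 m)) (cancel (+ m))
  where
  cancel : ∀ x → (1ℤ +ᶻ x) -ᶻ x ≡ 1ℤ
  cancel = solve-∀

Inc⇒Bit : ∀ {m k} → Inc m k → Bit (+ k -ᶻ + m)
Inc⇒Bit {m} (inj₁ refl) = inj₁ (ℤ.+-inverseʳ (+ m))
Inc⇒Bit {m} (inj₂ refl) = inj₂ (suc-⊖ m)

Bit⇒Inc : ∀ {m k x} → Bit x → + k ≡ + m +ᶻ x → Inc m k
Bit⇒Inc {m} (inj₁ refl) eq = inj₁ (ℤ.+-injective (trans eq (ℤ.+-identityʳ (+ m))))
Bit⇒Inc {m} (inj₂ refl) eq = inj₂ (ℤ.+-injective (trans eq (ℤ.+-comm (+ m) 1ℤ)))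

Bit-difference : ∀ {x y} → Bit x → Bit y → Ternary (x -ᶻ y)
Bit-difference (inj₁ refl) (inj₁ refl) = inj₁ refl
Bit-difference (inj₁ refl) (inj₂ refl) = inj₂ (inj₂ refl)
Bit-difference (inj₂ refl) (inj₁ refl) = inj₂ (inj₁ refl)
Bit-difference (inj₂ refl) (inj₂ refl) = inj₁ refl

module _ {n C} (pr : Profile n C) where
  open Profile pr

  prefix-∂ : ∀ i b → prefix b (∂ C i) ≡ + C (suc i) b -ᶻ + C i b
  prefix-∂ i b = begin
    prefix b (∂ C i)                   ≡⟨ prefix-telescope b h ⟩
    h b -ᶻ h 0
      ≡⟨ cong₂ (λ x y → h b -ᶻ (+ x -ᶻ + y)) (left (suc i)) (left i) ⟩
    h b +ᶻ 0ℤ                          ≡⟨ ℤ.+-identityʳ (h b) ⟩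
    h b                                ∎
    where
    open ≡-Reasoning
    h : ℕ → ℤ
    h b = + C (suc i) b -ᶻ + C i b

  prefix-∂-bit : ∀ i b → Bit (prefix b (∂ C i))
  prefix-∂-bit i b = subst Bit (sym (prefix-∂ i b)) (Inc⇒Bit (down i b))

  prefix-∂-total : ∀ {i} → i < n → prefix n (∂ C i) ≡ 1ℤ
  prefix-∂-total {i} i<n = begin
    prefix n (∂ C i)              ≡⟨ prefix-∂ i n ⟩
    + C (suc i) n -ᶻ + C i n
      ≡⟨ cong₂ (λ x y → + x -ᶻ + y) (trans (rim (suc i) n (inj₂ ≤-refl)) (m≤n⇒m⊓n≡m i<n))
          (trans (rim i n (inj₂ ≤-refl)) (m≤n⇒m⊓n≡m (<⇒≤ i<n))) ⟩
    + suc i -ᶻ + i                ≡⟨ suc-⊖ i ⟩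
    1ℤ                            ∎
    where open ≡-Reasoning

-- Prefix sums of a row are downward increments of `C`, hence bits; an entry is a difference of two
-- such bits, and columns are the rows of `flip C`.
restrict-∂-isASM : ∀ {n C} → Profile n C → IsASM (restrict n (∂ C))
restrict-∂-isASM {n} {C} pr = record
  { entries         = λ r c →
      Bit-difference (Inc⇒Bit (down (toℕ r) (suc (toℕ c)))) (Inc⇒Bit (down (toℕ r) (toℕ c)))
  ; row-sum         = λ r → prefix-∂-total pr (toℕ<n r)
  ; col-sum         = λ c →
      trans (∑-cong (λ (r : Fin n) → sym (∂-flip C (toℕ r) (toℕ c)))) (prefix-∂-total pr′ (toℕ<n c))
  ; row-alternating = λ r → bits⇒alternating n (∂ C (toℕ r)) (prefix-∂-bit pr (toℕ r))
  ; col-alternating = λ c → Alternating-resp-≗ (λ (r : Fin n) → ∂-flip C (toℕ r) (toℕ c))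
                              (bits⇒alternating n (∂ (flip C) (toℕ c)) (prefix-∂-bit pr′ (toℕ c)))
  }
  where
  open Profile pr
  pr′ : Profile n (flip C)
  pr′ = Profile-flip pr

δ : ℕ → ℕ → ℤ
δ i j = if does (i ≟ j) then 1ℤ else 0ℤ

δ-diagonal : ∀ i → δ i i ≡ 1ℤ
δ-diagonal i = cong (if_then 1ℤ else 0ℤ) (dec-true (i ≟ i) refl)

δ-off : ∀ {i j} → i ≢ j → δ i j ≡ 0ℤ
δ-off {i} {j} i≢j = cong (if_then 1ℤ else 0ℤ) (dec-false (i ≟ j) i≢j)

δ-sym : ∀ i j → δ i j ≡ δ j i
δ-sym i j with i ≟ j
... | yes refl = refl
... | no i≢j   = trans (δ-off i≢j) (sym (δ-off (i≢j ∘ sym)))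

prefix-cong : ∀ n {g h : ℕ → ℤ} → (∀ j → g j ≡ h j) → prefix n g ≡ prefix n h
prefix-cong n g≡h = ∑-cong {n} (g≡h ∘ toℕ)

prefix-δ-≤ : ∀ i b → b ≤ i → prefix b (δ i) ≡ 0ℤ
prefix-δ-≤ i zero    b≤i = refl
prefix-δ-≤ i (suc b) b<i =
  trans (prefix-suc b (δ i)) (cong₂ _+ᶻ_ (prefix-δ-≤ i b (<⇒≤ b<i)) (δ-off (>⇒≢ b<i)))

prefix-δ-> : ∀ i b → i < b → prefix b (δ i) ≡ 1ℤ
prefix-δ-> i (suc b) (s≤s i≤b) with m≤n⇒m<n∨m≡n i≤b
... | inj₁ i<b  = trans (prefix-suc b (δ i)) (cong₂ _+ᶻ_ (prefix-δ-> i b i<b) (δ-off (<⇒≢ i<b)))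
... | inj₂ refl = trans (prefix-suc b (δ i)) (cong₂ _+ᶻ_ (prefix-δ-≤ i i ≤-refl) (δ-diagonal i))

prefix-const-beyond : ∀ {n} g → (∀ j → n ≤ j → g j ≡ 0ℤ) → ∀ b → n ≤ b → prefix b g ≡ prefix n g
prefix-const-beyond {n} g out b n≤b with m≤n⇒m<n∨m≡n n≤b
... | inj₂ refl = refl
prefix-const-beyond {n} g out (suc b) n≤b | inj₁ (s≤s n≤b′) = begin
  prefix (suc b) g         ≡⟨ prefix-suc b g ⟩
  prefix b g +ᶻ g b        ≡⟨ cong₂ _+ᶻ_ (prefix-const-beyond g out b n≤b′) (out b n≤b′) ⟩
  prefix n g +ᶻ 0ℤ         ≡⟨ ℤ.+-identityʳ _ ⟩
  prefix n g               ∎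
  where open ≡-Reasoning

extend : ∀ {n} → Matrix n → ℕ → ℕ → ℤ
extend {n} A i j with i <? n | j <? n
... | yes i<n | yes j<n = A (fromℕ< i<n) (fromℕ< j<n)
... | _       | _       = δ i j

extend-inside : ∀ {n} (A : Matrix n) r c → extend A (toℕ r) (toℕ c) ≡ A r c
extend-inside {n} A r c with toℕ r <? n | toℕ c <? n
... | yes p | yes q = cong₂ A (fromℕ<-toℕ r p) (fromℕ<-toℕ c q)
... | yes _ | no ¬q = contradiction (toℕ<n c) ¬q
... | no ¬p | _     = contradiction (toℕ<n r) ¬p

extend-outside : ∀ {n} (A : Matrix n) i j → n ≤ i ⊎ n ≤ j → extend A i j ≡ δ i j
extend-outside {n} A i j out with i <? n | j <? n | out
... | yes p | yes q | inj₁ n≤i = contradiction p (≤⇒≯ n≤i)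
... | yes p | yes q | inj₂ n≤j = contradiction q (≤⇒≯ n≤j)
... | yes _ | no _  | _        = refl
... | no _  | _     | _        = refl

extend-flip : ∀ {n} (A : Matrix n) i j → extend (flip A) j i ≡ extend A i j
extend-flip {n} A i j with i <? n | j <? n
... | yes _ | yes _ = refl
... | yes _ | no _  = δ-sym j i
... | no _  | yes _ = δ-sym j i
... | no _  | no _  = δ-sym j i

δ-ternary : ∀ i j → Ternary (δ i j)
δ-ternary i j with does (i ≟ j)
... | true  = inj₂ (inj₁ refl)
... | false = inj₁ refl

extend-ternary : ∀ {n} {A : Matrix n} → IsASM A → ∀ i j → Ternary (extend A i j)
extend-ternary {n} asm i j with i <? n | j <? n
... | yes p | yes q = IsASM.entries asm (fromℕ< p) (fromℕ< q)
... | yes _ | no _  = δ-ternary i j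
... | no _  | _     = δ-ternary i j

module _ {n} {A : Matrix n} (asm : IsASM A) where
  open IsASM asm

  segment-extend : ∀ {i} (i<n : i < n) → A (fromℕ< i<n) ≗ segment n (extend A i)
  segment-extend {i} i<n c =
    trans (sym (extend-inside A (fromℕ< i<n) c)) (cong (λ k → extend A k (toℕ c)) (toℕ-fromℕ< i<n))

  prefix-extend-> : ∀ i b → n ≤ i ⊎ n ≤ b → i < b → prefix b (extend A i) ≡ 1ℤ
  prefix-extend-> i b out i<b with <-≤-connex i n | out
  ... | inj₁ i<n | inj₁ n≤i = contradiction i<n (≤⇒≯ n≤i)
  ... | inj₁ i<n | inj₂ n≤b =
    trans (prefix-const-beyond (extend A i)
        (λ j n≤j → trans (extend-outside A i j (inj₂ n≤j)) (δ-off (<⇒≢ (<-≤-trans i<n n≤j)))) b n≤b)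
          (trans (sym (∑-cong (segment-extend i<n))) (row-sum (fromℕ< i<n)))
  ... | inj₂ n≤i | _ =
    trans (prefix-cong b (λ j → extend-outside A i j (inj₁ n≤i))) (prefix-δ-> i b i<b)

  prefix-extend-≤ : ∀ i b → n ≤ i → b ≤ i → prefix b (extend A i) ≡ 0ℤ
  prefix-extend-≤ i b n≤i b≤i =
    trans (prefix-cong b (λ j → extend-outside A i j (inj₁ n≤i))) (prefix-δ-≤ i b b≤i)

  -- Inside the square this is the alternation of the row. Further right the full row sum 1 has been
  -- collected, and further down the row is one of the identity.
  prefix-extend-bit : ∀ i b → Bit (prefix b (extend A i))
  prefix-extend-bit i b with <-≤-connex i n | ≤-<-connex b n | <-≤-connex i b
  ... | inj₁ i<n | inj₁ b≤n | _ =
    alternating⇒bits n (extend-ternary asm i)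
      (Alternating-resp-≗ (segment-extend i<n) (row-alternating (fromℕ< i<n)))
      (trans (sym (∑-cong (segment-extend i<n))) (row-sum (fromℕ< i<n))) b b≤n
  ... | inj₁ i<n | inj₂ n<b | _ =
    inj₂ (prefix-extend-> i b (inj₂ (<⇒≤ n<b)) (<-trans i<n n<b))
  ... | inj₂ n≤i | _ | inj₁ i<b = inj₂ (prefix-extend-> i b (inj₁ n≤i) i<b)
  ... | inj₂ n≤i | _ | inj₂ b≤i  = inj₁ (prefix-extend-≤ i b n≤i b≤i)

-- The absolute value only makes the partial sum a natural number: for an alternating sign matrix
-- that sum is 0 or 1.
corner : ∀ {n} → Matrix n → ℕ → ℕ → ℕ
corner A zero    b = 0
corner A (suc a) b = corner A a b + ∣ prefix b (extend A a) ∣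

Bit⇒+∣x∣≡x : ∀ {x} → Bit x → + ∣ x ∣ ≡ x
Bit⇒+∣x∣≡x (inj₁ refl) = refl
Bit⇒+∣x∣≡x (inj₂ refl) = refl

corner-down : ∀ {n} {A : Matrix n} → IsASM A → ∀ a b →
              + corner A (suc a) b ≡ + corner A a b +ᶻ prefix b (extend A a)
corner-down {A = A} asm a b =
  trans (ℤ.pos-+ (corner A a b) _)
      (cong (+ corner A a b +ᶻ_) (Bit⇒+∣x∣≡x (prefix-extend-bit asm a b)))

corner-left : ∀ {n} (A : Matrix n) a → corner A a 0 ≡ 0
corner-left A zero    = refl
corner-left A (suc a) = trans (+-identityʳ (corner A a 0)) (corner-left A a)

-- The block is built up by rows; the induction on a exchanges the order of summation and shows it
-- built up by columns.
corner-right : ∀ {n} {A : Matrix n} → IsASM A → ∀ a b →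
               + corner A a (suc b) ≡ + corner A a b +ᶻ prefix a (extend (flip A) b)
corner-right asm zero b = refl
corner-right {A = A} asm (suc a) b = begin
  + corner A (suc a) (suc b)
    ≡⟨ corner-down asm a (suc b) ⟩
  + corner A a (suc b) +ᶻ prefix (suc b) (extend A a)
    ≡⟨ cong₂ _+ᶻ_ (corner-right asm a b) (prefix-suc b (extend A a)) ⟩
  (+ corner A a b +ᶻ prefix a (extend (flip A) b)) +ᶻ (prefix b (extend A a) +ᶻ extend A a b)
    ≡⟨ interchange (+ corner A a b) (prefix a (extend (flip A) b)) (prefix b (extend A a))
        (extend A a b) ⟩
  (+ corner A a b +ᶻ prefix b (extend A a)) +ᶻ (prefix a (extend (flip A) b) +ᶻ extend A a b)
    ≡⟨ cong₂ _+ᶻ_ (sym (corner-down asm a b))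
         (trans (cong (prefix a (extend (flip A) b) +ᶻ_) (sym (extend-flip A a b)))
             (sym (prefix-suc a (extend (flip A) b)))) ⟩
  + corner A (suc a) b +ᶻ prefix (suc a) (extend (flip A) b) ∎
  where
  open ≡-Reasoning
  interchange : ∀ x y z w → (x +ᶻ y) +ᶻ (z +ᶻ w) ≡ (x +ᶻ z) +ᶻ (y +ᶻ w)
  interchange = solve-∀

corner-flip : ∀ {n} {A : Matrix n} → IsASM A → ∀ a b → corner (flip A) b a ≡ corner A a b
corner-flip {A = A} asm a zero    = sym (corner-left A a)
corner-flip {A = A} asm a (suc b) = ℤ.+-injective (begin
  + corner (flip A) (suc b) a                              ≡⟨ corner-down (IsASM-flip asm) b a ⟩
  + corner (flip A) b a +ᶻ prefix a (extend (flip A) b)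
    ≡⟨ cong (λ k → + k +ᶻ prefix a (extend (flip A) b)) (corner-flip asm a b) ⟩
  + corner A a b +ᶻ prefix a (extend (flip A) b)           ≡⟨ corner-right asm a b ⟨
  + corner A a (suc b)                                     ∎)
  where open ≡-Reasoning

corner-rim : ∀ {n} {A : Matrix n} → IsASM A → ∀ a b → n ≤ b → corner A a b ≡ a ⊓ b
corner-rim asm zero    b n≤b = refl
corner-rim {A = A} asm (suc a) b n≤b with a <? b
... | yes a<b = begin
  corner A a b + ∣ prefix b (extend A a) ∣
    ≡⟨ cong₂ (λ m x → m + ∣ x ∣) (corner-rim asm a b n≤b) (prefix-extend-> asm a b (inj₂ n≤b) a<b) ⟩
  a ⊓ b + 1                                ≡⟨ +-comm (a ⊓ b) 1 ⟩
  suc (a ⊓ b)                              ≡⟨ cong suc (m≤n⇒m⊓n≡m (<⇒≤ a<b)) ⟩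
  suc a                                    ≡⟨ m≤n⇒m⊓n≡m a<b ⟨
  suc a ⊓ b                                ∎
  where open ≡-Reasoning
... | no a≮b = let b≤a = ≮⇒≥ a≮b in begin
  corner A a b + ∣ prefix b (extend A a) ∣
    ≡⟨ cong₂ (λ m x → m + ∣ x ∣) (corner-rim asm a b n≤b)
        (prefix-extend-≤ asm a b (≤-trans n≤b b≤a) b≤a) ⟩
  a ⊓ b + 0                                ≡⟨ +-identityʳ (a ⊓ b) ⟩
  a ⊓ b                                    ≡⟨ m≥n⇒m⊓n≡n b≤a ⟩
  b                                        ≡⟨ m≥n⇒m⊓n≡n (m≤n⇒m≤1+n b≤a) ⟨
  suc a ⊓ b                                ∎
  where open ≡-Reasoning

corner-profile : ∀ {n} {A : Matrix n} → IsASM A → Profile n (corner A)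
corner-profile {n} {A} asm = record
  { top   = λ b → refl
  ; left  = corner-left A
  ; right = λ a b → Bit⇒Inc (prefix-extend-bit (IsASM-flip asm) b a) (corner-right asm a b)
  ; down  = λ a b → Bit⇒Inc (prefix-extend-bit asm a b) (corner-down asm a b)
  ; rim   = rim
  }
  where
  rim : ∀ a b → n ≤ a ⊎ n ≤ b → corner A a b ≡ a ⊓ b
  rim a b (inj₂ n≤b) = corner-rim asm a b n≤b
  rim a b (inj₁ n≤a) = begin
    corner A a b          ≡⟨ corner-flip asm a b ⟨
    corner (flip A) b a   ≡⟨ corner-rim (IsASM-flip asm) b a n≤a ⟩
    b ⊓ a                 ≡⟨ ⊓-comm b a ⟩
    a ⊓ b                 ∎
    where open ≡-Reasoning

restrict-∂-corner : ∀ {n} {A : Matrix n} → IsASM A → restrict n (∂ (corner A)) ≋ A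
restrict-∂-corner {n} {A} asm r c = begin
  ∂ (corner A) i j
    ≡⟨ cong₂ (λ x y → (x -ᶻ + corner A i (suc j)) -ᶻ (y -ᶻ + corner A i j))
        (corner-down asm i (suc j)) (corner-down asm i j) ⟩
  ((+ corner A i (suc j) +ᶻ prefix (suc j) (extend A i)) -ᶻ + corner A i (suc j)) -ᶻ
  ((+ corner A i j +ᶻ prefix j (extend A i)) -ᶻ + corner A i j)
    ≡⟨ cong (λ x → ((+ corner A i (suc j) +ᶻ x) -ᶻ + corner A i (suc j)) -ᶻ
                   ((+ corner A i j +ᶻ prefix j (extend A i)) -ᶻ + corner A i j))
            (prefix-suc j (extend A i)) ⟩
  _ ≡⟨ cancel (+ corner A i (suc j)) (+ corner A i j) (prefix j (extend A i)) (extend A i j) ⟩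
  extend A i j
    ≡⟨ extend-inside A r c ⟩
  A r c ∎
  where
  open ≡-Reasoning
  i j : ℕ
  i = toℕ r
  j = toℕ c
  cancel : ∀ x y p e → ((x +ᶻ (p +ᶻ e)) -ᶻ x) -ᶻ ((y +ᶻ p) -ᶻ y) ≡ e
  cancel = solve-∀

-- X-rays and sums over antidiagonals

diag : ℕ → (ℕ → ℕ → ℤ) → ℤ
diag zero    g = g 0 0
diag (suc t) g = g 0 (suc t) +ᶻ diag t (g ∘ suc)

diag-zero : ∀ t g → (∀ i j → i + j ≡ t → g i j ≡ 0ℤ) → diag t g ≡ 0ℤ
diag-zero zero    g vanish = vanish 0 0 refl
diag-zero (suc t) g vanish =
  cong₂ _+ᶻ_ (vanish 0 (suc t) refl)
      (diag-zero t (g ∘ suc) λ i j eq → vanish (suc i) j (cong suc eq))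

∑-zero : ∀ n → ∑ {n} (λ _ → 0ℤ) ≡ 0ℤ
∑-zero = sum-replicate-zero ℤ.+-0-monoid

∑-pick : ∀ n k (h : ℕ → ℤ) → (n ≤ k → h k ≡ 0ℤ) →
         ∑ {n} (λ j → if does (toℕ j ≟ k) then h (toℕ j) else 0ℤ) ≡ h k
∑-pick zero    k       h vanish = sym (vanish z≤n)
∑-pick (suc n) zero    h vanish = trans (cong (h 0 +ᶻ_) (∑-zero n)) (ℤ.+-identityʳ (h 0))
∑-pick (suc n) (suc k) h vanish = trans (ℤ.+-identityˡ _) (∑-pick n k (h ∘ suc) (vanish ∘ s≤s))

-- `vanish` covers the cells of the antidiagonal that lie in the quadrant but outside the m by n
-- rectangle.
∑-diag : ∀ m n k g → (∀ i j → i + j ≡ k → m ≤ i ⊎ n ≤ j → g i j ≡ 0ℤ) →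
         ∑ {m} (λ i → ∑ {n} λ j → if does (toℕ i + toℕ j ≟ k) then g (toℕ i) (toℕ j) else 0ℤ)
             ≡ diag k g
∑-diag zero n k g vanish = sym (diag-zero k g λ i j eq → vanish i j eq (inj₁ z≤n))
∑-diag (suc m) n zero g vanish = begin
  ∑ {n} _ +ᶻ ∑ {m} (λ i → ∑ {n} λ j → 0ℤ)
    ≡⟨ cong₂ _+ᶻ_ (∑-pick n 0 (g 0) (vanish 0 0 refl ∘ inj₂)) (∑-cong {m} λ _ → ∑-zero n) ⟩
  g 0 0 +ᶻ ∑ {m} (λ i → 0ℤ)
    ≡⟨ cong (g 0 0 +ᶻ_) (∑-zero m) ⟩
  g 0 0 +ᶻ 0ℤ
    ≡⟨ ℤ.+-identityʳ (g 0 0) ⟩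
  g 0 0 ∎
  where open ≡-Reasoning
∑-diag (suc m) n (suc k) g vanish =
  cong₂ _+ᶻ_ (∑-pick n (suc k) (g 0) (vanish 0 (suc k) refl ∘ inj₂))
    (∑-diag m n k (g ∘ suc) λ i j eq out → vanish (suc i) j (cong suc eq) (Sum.map₁ s≤s out))

layer : ℕ → (ℕ → ℕ → ℕ) → ℕ
layer zero    C = C 0 0
layer (suc t) C = C 0 (suc t) + layer t (C ∘ suc)

layer-snoc : ∀ t C → layer (suc t) C ≡ layer t (λ a b → C a (suc b)) + C (suc t) 0
layer-snoc zero    C = refl
layer-snoc (suc t) C =
  trans (cong (λ x → C 0 (suc (suc t)) + x) (layer-snoc t (C ∘ suc)))
      (sym (+-assoc (C 0 (suc (suc t))) _ _))

layer-flip : ∀ t C → layer t (flip C) ≡ layer t C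
layer-flip zero    C = refl
layer-flip (suc t) C = begin
  C (suc t) 0 + layer t (flip λ a b → C a (suc b))
    ≡⟨ cong (λ x → C (suc t) 0 + x) (layer-flip t _) ⟩
  C (suc t) 0 + layer t (λ a b → C a (suc b))      ≡⟨ +-comm (C (suc t) 0) _ ⟩
  layer t (λ a b → C a (suc b)) + C (suc t) 0      ≡⟨ layer-snoc t C ⟨
  layer (suc t) C                                  ∎
  where open ≡-Reasoning

layer-+ : ∀ t C D → layer t (λ a b → C a b + D a b) ≡ layer t C + layer t D
layer-+ zero    C D = refl
layer-+ (suc t) C D =
  trans (cong (λ x → C 0 (suc t) + D 0 (suc t) + x) (layer-+ t (C ∘ suc) (D ∘ suc)))
        (CommutativeSemigroup.interchange +-commutativeSemigroup (C 0 (suc t))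
            (D 0 (suc t)) (layer t (C ∘ suc)) (layer t (D ∘ suc)))

layer-cong : ∀ t {C D} → (∀ a b → a + b ≡ t → C a b ≡ D a b) → layer t C ≡ layer t D
layer-cong zero    eq = eq 0 0 refl
layer-cong (suc t) eq =
    cong₂ _+_ (eq 0 (suc t) refl) (layer-cong t λ a b p → eq (suc a) b (cong suc p))

layer-mono-≤ : ∀ t {C D} → (∀ a b → a + b ≡ t → C a b ≤ D a b) → layer t C ≤ layer t D
layer-mono-≤ zero    le = le 0 0 refl
layer-mono-≤ (suc t) le =
    +-mono-≤ (le 0 (suc t) refl) (layer-mono-≤ t λ a b p → le (suc a) b (cong suc p))

+-tight : ∀ {m n p q} → m ≤ n → p ≤ q → m + p ≡ n + q → m ≡ n × p ≡ q
+-tight {m} {n} {p} {q} m≤n p≤q eq = m≡n , +-cancelˡ-≡ m p q (trans eq (cong (_+ q) (sym m≡n)))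
  where
  m≡n : m ≡ n
  m≡n = ≤-antisym m≤n (+-cancelʳ-≤ q n m (≤-trans (≤-reflexive (sym eq)) (+-monoʳ-≤ m p≤q)))

-- Termwise bounds leave no slack once the sums agree. This turns one-sided estimates on an
-- antidiagonal into equalities.
layer-tight : ∀ t {C D} → (∀ a b → a + b ≡ t → C a b ≤ D a b) → layer t C ≡ layer t D →
              ∀ a b → a + b ≡ t → C a b ≡ D a b
layer-tight zero    le eq zero    .0 refl = eq
layer-tight (suc t) le eq zero    .(suc t) refl =
  proj₁ (+-tight (le 0 (suc t) refl) (layer-mono-≤ t λ a b p → le (suc a) b (cong suc p)) eq)
layer-tight (suc t) le eq (suc a) b p =
  layer-tight t (λ a b p → le (suc a) b (cong suc p))
    (proj₂ (+-tight (le 0 (suc t) refl) (layer-mono-≤ t λ a b p → le (suc a) b (cong suc p)) eq))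
    a b (suc-injective p)

diag-difference : ∀ t X Y Z W →
  diag t (λ i j → (+ X i j -ᶻ + Y i j) -ᶻ (+ Z i j -ᶻ + W i j)) ≡
  (+ layer t X -ᶻ + layer t Y) -ᶻ (+ layer t Z -ᶻ + layer t W)
diag-difference zero    X Y Z W = refl
diag-difference (suc t) X Y Z W = begin
  ((+ X 0 (suc t) -ᶻ + Y 0 (suc t)) -ᶻ (+ Z 0 (suc t) -ᶻ + W 0 (suc t))) +ᶻ diag t _
    ≡⟨ cong (((+ X 0 (suc t) -ᶻ + Y 0 (suc t)) -ᶻ (+ Z 0 (suc t) -ᶻ + W 0 (suc t))) +ᶻ_)
         (diag-difference t (X ∘ suc) (Y ∘ suc) (Z ∘ suc) (W ∘ suc)) ⟩
  _ ≡⟨ rearrange (+ X 0 (suc t)) (+ Y 0 (suc t)) (+ Z 0 (suc t)) (+ W 0 (suc t))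
         (+ layer t (X ∘ suc)) (+ layer t (Y ∘ suc)) (+ layer t (Z ∘ suc)) (+ layer t (W ∘ suc)) ⟩
  _ ≡⟨ cong₂ _-ᶻ_ (cong₂ _-ᶻ_ (pos X) (pos Y)) (cong₂ _-ᶻ_ (pos Z) (pos W)) ⟩
  (+ layer (suc t) X -ᶻ + layer (suc t) Y) -ᶻ (+ layer (suc t) Z -ᶻ + layer (suc t) W) ∎
  where
  open ≡-Reasoning
  pos : ∀ X → + X 0 (suc t) +ᶻ + layer t (X ∘ suc) ≡ + layer (suc t) X
  pos X = sym (ℤ.pos-+ (X 0 (suc t)) (layer t (X ∘ suc)))
  rearrange : ∀ x y z w x′ y′ z′ w′ →
    ((x -ᶻ y) -ᶻ (z -ᶻ w)) +ᶻ ((x′ -ᶻ y′) -ᶻ (z′ -ᶻ w′)) ≡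
    ((x +ᶻ x′) -ᶻ (y +ᶻ y′)) -ᶻ ((z +ᶻ z′) -ᶻ (w +ᶻ w′))
  rearrange = solve-∀

module _ {n C} (pr : Profile n C) where
  open Profile pr

  layer-down : ∀ t → layer (suc t) C ≡ layer t (C ∘ suc)
  layer-down t = cong (_+ layer t (C ∘ suc)) (top (suc t))

  layer-right : ∀ t → layer (suc t) C ≡ layer t (λ a b → C a (suc b))
  layer-right t = begin
    layer (suc t) C                             ≡⟨ layer-snoc t C ⟩
    layer t (λ a b → C a (suc b)) + C (suc t) 0
      ≡⟨ cong (λ x → layer t (λ a b → C a (suc b)) + x) (left (suc t)) ⟩
    layer t (λ a b → C a (suc b)) + 0           ≡⟨ +-identityʳ _ ⟩
    layer t (λ a b → C a (suc b))               ∎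
    where open ≡-Reasoning

  -- Row 0 and column 0 of `C` vanish, so moving `C` by one cell, down or right, turns the sum over
  -- one antidiagonal into that over the next. The mixed difference thereby becomes a second
  -- difference in t.
  diag-∂ : ∀ t → diag t (∂ C) ≡
    (+ layer (suc (suc t)) C -ᶻ + layer (suc t) C) -ᶻ (+ layer (suc t) C -ᶻ + layer t C)
  diag-∂ t = begin
    diag t (∂ C)
      ≡⟨ diag-difference t (λ a b → C (suc a) (suc b)) (λ a b → C a (suc b)) (C ∘ suc) C ⟩
    (+ layer t (λ a b → C (suc a) (suc b)) -ᶻ + layer t (λ a b → C a (suc b))) -ᶻ
        (+ layer t (C ∘ suc) -ᶻ + layer t C)
      ≡⟨ cong₂ _-ᶻ_ (cong₂ (λ x y → + x -ᶻ + y) corner-layer (sym (layer-right t)))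
                    (cong (λ x → + x -ᶻ + layer t C) (sym (layer-down t))) ⟩
    (+ layer (suc (suc t)) C -ᶻ + layer (suc t) C) -ᶻ (+ layer (suc t) C -ᶻ + layer t C) ∎
    where
    open ≡-Reasoning
    corner-layer : layer t (λ a b → C (suc a) (suc b)) ≡ layer (suc (suc t)) C
    corner-layer = sym (begin
      layer (suc (suc t)) C                                           ≡⟨ layer-down (suc t) ⟩
      layer (suc t) (C ∘ suc)                                         ≡⟨ layer-snoc t (C ∘ suc) ⟩
      layer t (λ a b → C (suc a) (suc b)) + C (suc (suc t)) 0
        ≡⟨ cong (λ x → layer t (λ a b → C (suc a) (suc b)) + x) (left (suc (suc t))) ⟩
      layer t (λ a b → C (suc a) (suc b)) + 0                         ≡⟨ +-identityʳ _ ⟩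
      layer t (λ a b → C (suc a) (suc b))                             ∎)

  ∂-below : ∀ i j → n ≤ i → j < n → ∂ C i j ≡ 0ℤ
  ∂-below i j n≤i j<n = begin
    ∂ C i j
      ≡⟨ cong₂ _-ᶻ_
           (cong₂ column (value (suc i) (suc j) n≤1+i j<n) (value i (suc j) n≤i j<n))
           (cong₂ column (value (suc i) j n≤1+i (<⇒≤ j<n)) (value i j n≤i (<⇒≤ j<n))) ⟩
    (+ suc j -ᶻ + suc j) -ᶻ (+ j -ᶻ + j)
      ≡⟨ cong₂ _-ᶻ_ (ℤ.+-inverseʳ (+ suc j)) (ℤ.+-inverseʳ (+ j)) ⟩
    0ℤ                                                ∎
    where
    open ≡-Reasoning
    column : ℕ → ℕ → ℤ
    column x y = + x -ᶻ + y
    n≤1+i : n ≤ suc i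
    n≤1+i = m≤n⇒m≤1+n n≤i
    value : ∀ a b → n ≤ a → b ≤ n → C a b ≡ b
    value a b n≤a b≤n = trans (rim a b (inj₁ n≤a)) (m≥n⇒m⊓n≡n (≤-trans b≤n n≤a))

-- Antidiagonals met by the X-ray satisfy i + j ≤ 2n - 2, so if one coordinate is at least n, the
-- other is below n, and the continued identity has no 1 there.
∂-outside : ∀ {n C} → Profile n C → ∀ i j → suc (i + j) < n + n → n ≤ i ⊎ n ≤ j → ∂ C i j ≡ 0ℤ
∂-outside {n} pr i j i+j< (inj₁ n≤i) =
  ∂-below pr i j n≤i (+-cancelˡ-< n j n (≤-<-trans (+-monoˡ-≤ j n≤i) (<-trans (n<1+n _) i+j<)))
∂-outside {n} {C} pr i j i+j< (inj₂ n≤j) =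
  trans (sym (∂-flip C i j)) (∂-below (Profile-flip pr) j i n≤j
    (+-cancelʳ-< n i n (≤-<-trans (+-monoʳ-≤ i n≤j) (<-trans (n<1+n _) i+j<))))

xray-layers : ∀ {n C} → Profile n C → (k : Fin (2 * n ∸ 1)) → let t = toℕ k in
  xray (restrict n (∂ C)) k ≡
  (+ layer (suc (suc t)) C -ᶻ + layer (suc t) C) -ᶻ (+ layer (suc t) C -ᶻ + layer t C)
xray-layers {n} {C} pr k = begin
  xray (restrict n (∂ C)) k
    ≡⟨ (∑-cong {n} λ i → ∑-cong {n} λ j → cong (if_then ∂ C (toℕ i) (toℕ j) else 0ℤ) (test i j)) ⟩
  _ ≡⟨ ∑-diag n n (toℕ k) (∂ C)
      (λ i j eq → ∂-outside pr i j (subst (λ t → suc t < n + n) (sym eq) k<)) ⟩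
  diag (toℕ k) (∂ C)
    ≡⟨ diag-∂ pr (toℕ k) ⟩
  _ ∎
  where
  open ≡-Reasoning
  test : ∀ (i j : Fin n) → does (num i + num j ≟ num k + 1) ≡ does (toℕ i + toℕ j ≟ toℕ k)
  test i j rewrite +-suc (toℕ i) (toℕ j) | +-comm (toℕ k) 1 = refl
  k< : suc (toℕ k) < n + n
  k< = subst (suc (toℕ k) <_) (cong (λ x → n + x) (+-identityʳ n)) (1+m≤o∸1⇒2+m≤o (toℕ<n k))
    where
    1+m≤o∸1⇒2+m≤o : ∀ {m o} → suc m ≤ o ∸ 1 → suc (suc m) ≤ o
    1+m≤o∸1⇒2+m≤o {o = suc o} = s≤s

xray-determined-by-layers : ∀ {n C D} → Profile n C → Profile n D → (∀ t → layer t C ≡ layer t D) →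
  xray (restrict n (∂ C)) ≗ xray (restrict n (∂ D))
xray-determined-by-layers prC prD same k = begin
  _ ≡⟨ xray-layers prC k ⟩
  _ ≡⟨ cong₂ (λ x y → x -ᶻ y)
      (cong₂ (λ x y → + x -ᶻ + y) (same (suc (suc (toℕ k)))) (same (suc (toℕ k))))
          (cong₂ (λ x y → + x -ᶻ + y) (same (suc (toℕ k))) (same (toℕ k))) ⟩
  _ ≡⟨ xray-layers prD k ⟨
  _ ∎
  where open ≡-Reasoning

-- The sums over the first two antidiagonals are 0 by the boundary values; the second differences
-- then give the others one at a time.
layers-determined-by-xray : ∀ {n C D} → Profile n C → Profile n D →
  xray (restrict n (∂ C)) ≗ xray (restrict n (∂ D)) →
  ∀ t → t ≤ 2 * n → layer t C ≡ layer t D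
layers-determined-by-xray {n} {C} {D} prC prD same = go
  where
  module C = Profile prC
  module D = Profile prD
  solveX : ∀ x y z → x ≡ ((x -ᶻ y) -ᶻ (y -ᶻ z)) +ᶻ (y +ᶻ (y -ᶻ z))
  solveX = solve-∀
  go : ∀ t → t ≤ 2 * n → layer t C ≡ layer t D
  go zero          _ = trans (C.top 0) (sym (D.top 0))
  go (suc zero)    _ =
      cong₂ _+_ (trans (C.top 1) (sym (D.top 1))) (trans (C.left 1) (sym (D.left 1)))
  go (suc (suc t)) t< = ℤ.+-injective (begin
    + layer (suc (suc t)) C   ≡⟨ solveX _ (+ layer (suc t) C) (+ layer t C) ⟩
    _ ≡⟨ cong₂ _+ᶻ_ second-≡
        (cong₂ (λ x y → + x +ᶻ (+ x -ᶻ + y)) (go (suc t) (<⇒≤ t<)) (go t (<⇒≤ (<⇒≤ t<)))) ⟩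
    _ ≡⟨ solveX _ (+ layer (suc t) D) (+ layer t D) ⟨
    + layer (suc (suc t)) D   ∎)
    where
    open ≡-Reasoning
    k : Fin (2 * n ∸ 1)
    -- The X-ray entry with index t, counted from 0, involves the antidiagonals t, t + 1 and t + 2;
    -- t + 2 ≤ 2n puts the index in range.
    k = fromℕ< (∸-monoˡ-≤ 1 t<)
    second : (ℕ → ℕ → ℕ) → ℕ → ℤ
    second C t = (+ layer (suc (suc t)) C -ᶻ + layer (suc t) C) -ᶻ
        (+ layer (suc t) C -ᶻ + layer t C)
    second-≡ : second C t ≡ second D t
    second-≡ = begin
      second C t                 ≡⟨ cong (second C) (toℕ-fromℕ< _) ⟨
      second C (toℕ k)           ≡⟨ xray-layers prC k ⟨
      xray (restrict n (∂ C)) k  ≡⟨ same k ⟩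
      xray (restrict n (∂ D)) k  ≡⟨ xray-layers prD k ⟩
      second D (toℕ k)           ≡⟨ cong (second D) (toℕ-fromℕ< _) ⟩
      second D t                 ∎

-- Corner sums constant along antidiagonals

Inc⇒≤ : ∀ {m k} → Inc m k → m ≤ k
Inc⇒≤ (inj₁ refl) = ≤-refl
Inc⇒≤ (inj₂ refl) = n≤1+n _

Inc⇒≤suc : ∀ {m k} → Inc m k → k ≤ suc m
Inc⇒≤suc (inj₁ refl) = n≤1+n _
Inc⇒≤suc (inj₂ refl) = ≤-refl

≤∧≤suc⇒Inc : ∀ {m k} → m ≤ k → k ≤ suc m → Inc m k
≤∧≤suc⇒Inc m≤k k≤1+m with m≤n⇒m<n∨m≡n m≤k
... | inj₁ m<k = inj₂ (≤-antisym k≤1+m m<k)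
... | inj₂ m≡k = inj₁ (sym m≡k)

Inc-⊓ : ∀ {m m′ k k′} → Inc m m′ → Inc k k′ → Inc (m ⊓ k) (m′ ⊓ k′)
Inc-⊓ p q = ≤∧≤suc⇒Inc (⊓-mono-≤ (Inc⇒≤ p) (Inc⇒≤ q)) (⊓-mono-≤ (Inc⇒≤suc p) (Inc⇒≤suc q))

m+m≤1+k+k⇒m≤k : ∀ {m k} → m + m ≤ suc (k + k) → m ≤ k
m+m≤1+k+k⇒m≤k {m} {k} le with <-≤-connex k m
... | inj₂ m≤k = m≤k
... | inj₁ k<m = contradiction (subst (_≤ m + m) (cong suc (+-suc k k)) (+-mono-≤ k<m k<m)) (≤⇒≯ le)

m+m≡k+k⇒m≡k : ∀ {m k} → m + m ≡ k + k → m ≡ k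
m+m≡k+k⇒m≡k eq = ≤-antisym (m+m≤1+k+k⇒m≤k (m≤n⇒m≤1+n (≤-reflexive eq)))
                           (m+m≤1+k+k⇒m≤k (m≤n⇒m≤1+n (≤-reflexive (sym eq))))

-- `f t` plays the number of steps S among the first t steps; `half` says that the path stays weakly
-- above the main diagonal.
record Height (f : ℕ → ℕ) : Set where
  field
    start : f 0 ≡ 0
    step  : ∀ t → Inc (f t) (f (suc t))
    half  : ∀ t → f t + f t ≤ t

cap : (ℕ → ℕ) → ℕ → ℕ → ℕ
cap f a b = a ⊓ b ⊓ f (a + b)

module _ (f : ℕ → ℕ) (a b : ℕ) where
  cap≤row : cap f a b ≤ a
  cap≤row = ≤-trans (m⊓n≤m (a ⊓ b) (f (a + b))) (m⊓n≤m a b)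

  cap≤col : cap f a b ≤ b
  cap≤col = ≤-trans (m⊓n≤m (a ⊓ b) (f (a + b))) (m⊓n≤n a b)

  cap≤height : cap f a b ≤ f (a + b)
  cap≤height = m⊓n≤n (a ⊓ b) (f (a + b))

  cap-glb : ∀ {x} → x ≤ a → x ≤ b → x ≤ f (a + b) → x ≤ cap f a b
  cap-glb x≤a x≤b x≤f = ⊓-glb (⊓-glb x≤a x≤b) x≤f

module _ {n C} (pr : Profile n C) where
  open Profile pr

  profile≤row : ∀ a b → C a b ≤ a
  profile≤row zero    b = ≤-reflexive (top b)
  profile≤row (suc a) b = ≤-trans (Inc⇒≤suc (down a b)) (s≤s (profile≤row a b))

profile≤col : ∀ {n C} → Profile n C → ∀ a b → C a b ≤ b
profile≤col pr a b = profile≤row (Profile-flip pr) b a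

-- Equality spreads from one antidiagonal to the next: if the height stays
-- constant, cap f is the least continuation, and if it increases, the greatest;
-- the antidiagonal sums do the rest.
module _ {n C f} (pr : Profile n C) (ht : Height f) where
  open Profile pr
  open Height ht

  layers-determine-cap : ∀ N → (∀ t → t ≤ N → layer t (cap f) ≡ layer t C) →
                         ∀ t → t ≤ N → ∀ a b → a + b ≡ t → cap f a b ≡ C a b
  layers-determine-cap N same zero    _   zero zero _ = sym (top 0)
  layers-determine-cap N same (suc t) t<N a b eq = conclude (step t)
    where
    previous : ∀ a b → a + b ≡ t → cap f a b ≡ C a b
    previous = layers-determine-cap N same t (<⇒≤ t<N)

    -- After a step E, the neighbour towards the main diagonal on the previous antidiagonal has the
    -- same height and, off the diagonal, the same minimum of its coordinates. Hence `cap` is no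
    -- smaller there, and `C` does not decrease from there.
    below : f (suc t) ≡ f t → ∀ a b → a + b ≡ suc t → cap f a b ≤ C a b
    below level a b eq with <-cmp a b
    below level a (suc b) eq | tri< (s≤s a≤b) _ _ = begin
      cap f a (suc b)
        ≤⟨ cap-glb f a b (cap≤row f a (suc b)) (≤-trans (cap≤row f a (suc b)) a≤b) bound ⟩
      cap f a b        ≡⟨ previous a b a+b≡t ⟩
      C a b            ≤⟨ Inc⇒≤ (right a b) ⟩
      C a (suc b)      ∎
      where
      open ≤-Reasoning
      a+b≡t : a + b ≡ t
      a+b≡t = suc-injective (trans (sym (+-suc a b)) eq)
      bound : cap f a (suc b) ≤ f (a + b)
      bound = begin
        cap f a (suc b) ≤⟨ cap≤height f a (suc b) ⟩
        f (a + suc b)   ≡⟨ trans (cong f eq) level ⟩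
        f t             ≡⟨ cong f a+b≡t ⟨
        f (a + b)       ∎
    below level (suc a) b eq | tri> _ _ (s≤s b≤a) = begin
      cap f (suc a) b
        ≤⟨ cap-glb f a b (≤-trans (cap≤col f (suc a) b) b≤a) (cap≤col f (suc a) b) bound ⟩
      cap f a b        ≡⟨ previous a b (suc-injective eq) ⟩
      C a b            ≤⟨ Inc⇒≤ (down a b) ⟩
      C (suc a) b      ∎
      where
      open ≤-Reasoning
      bound : cap f (suc a) b ≤ f (a + b)
      bound = begin
        cap f (suc a) b ≤⟨ cap≤height f (suc a) b ⟩
        f (suc a + b)   ≡⟨ trans (cong f eq) level ⟩
        f t             ≡⟨ cong f (suc-injective eq) ⟨
        f (a + b)       ∎
    -- On the main diagonal the neighbour has the smaller minimum a. Here t is 2a + 1, so `half`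
    -- gives `f t ≤ a` and the cap is not affected.
    below level (suc a) (suc a) eq | tri≈ _ refl _ = begin
      cap f (suc a) (suc a)
        ≤⟨ cap-glb f a (suc a) (≤-trans bound half-a) (cap≤col f (suc a) (suc a))
            (≤-trans bound (≤-reflexive (cong f (sym (suc-injective eq))))) ⟩
      cap f a (suc a)       ≡⟨ previous a (suc a) (suc-injective eq) ⟩
      C a (suc a)           ≤⟨ Inc⇒≤ (down a (suc a)) ⟩
      C (suc a) (suc a)     ∎
      where
      open ≤-Reasoning
      bound : cap f (suc a) (suc a) ≤ f t
      bound = ≤-trans (cap≤height f (suc a) (suc a)) (≤-reflexive (trans (cong f eq) level))
      half-a : f t ≤ a
      half-a = m+m≤1+k+k⇒m≤k
          (≤-trans (half t) (≤-reflexive (trans (sym (suc-injective eq)) (+-suc a a))))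

    -- After a step S, the bound by height follows from the cell above, since `C` grows by at most 1
    -- per row.
    above : f (suc t) ≡ suc (f t) → ∀ a b → a + b ≡ suc t → C a b ≤ cap f a b
    above rise a b eq = cap-glb f a b (profile≤row pr a b) (profile≤col pr a b)
      (≤-trans (bound a b eq) (≤-reflexive (sym (trans (cong f eq) rise))))
      where
      open ≤-Reasoning
      bound : ∀ a b → a + b ≡ suc t → C a b ≤ suc (f t)
      bound zero    b eq = ≤-trans (≤-reflexive (top b)) z≤n
      bound (suc a) b eq = begin
        C (suc a) b      ≤⟨ Inc⇒≤suc (down a b) ⟩
        suc (C a b)      ≡⟨ cong suc (previous a b (suc-injective eq)) ⟨
        suc (cap f a b)  ≤⟨ s≤s (cap≤height f a b) ⟩
        suc (f (a + b))  ≡⟨ cong (suc ∘ f) (suc-injective eq) ⟩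
        suc (f t)        ∎

    conclude : Inc (f t) (f (suc t)) → cap f a b ≡ C a b
    conclude (inj₁ level) = layer-tight (suc t) (below level) (same (suc t) t<N) a b eq
    conclude (inj₂ rise)  = sym (layer-tight (suc t) (above rise) (sym (same (suc t) t<N)) a b eq)

-- Translation along antidiagonals

-- C is translated along each antidiagonal by one step, except where it has
-- the largest possible value a ⊓ b.
slide : (ℕ → ℕ → ℕ) → ℕ → ℕ → ℕ
slide C zero    b = 0
slide C (suc a) b with b ≤? a | suc a ≤? C (suc a) b
... | yes _ | _     = b ⊓ C a (suc b)
... | no _  | yes _ = suc a
... | no _  | no _  = C a (suc b)

-- The value is an index, so that neighbouring cells can be compared by matching on their kinds. A
-- `lower` cell lies strictly below the main diagonal; for a profile the translated value can exceed
-- b by 1 there and is cut down.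
data Slide (C : ℕ → ℕ → ℕ) : ℕ → ℕ → ℕ → Set where
  saturated : ∀ {a b} → a ≤ b → C a b ≡ a → Slide C a b a
  shifted   : ∀ {a b} → a < b → C (suc a) b ≤ a → Slide C (suc a) b (C a (suc b))
  lower     : ∀ {a b} → b ≤ a → Slide C (suc a) b (b ⊓ C a (suc b))

module _ {n C} (pr : Profile n C) where
  open Profile pr

  slide-view : ∀ a b → Slide C a b (slide C a b)
  slide-view zero    b = saturated z≤n (top b)
  slide-view (suc a) b with b ≤? a | suc a ≤? C (suc a) b
  ... | yes b≤a | _       = lower b≤a
  ... | no b≰a  | yes a<C = saturated (≰⇒> b≰a) (≤-antisym (profile≤row pr (suc a) b) a<C)
  ... | no b≰a  | no a≮C  = shifted (≰⇒> b≰a) (≤-pred (≰⇒> a≮C))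

  corner≤ : ∀ a b → C (suc a) (suc b) ≤ suc (C a (suc b))
  corner≤ a b = Inc⇒≤suc (down a (suc b))

  -- The step to the right loses nothing and the step up loses at most 1.
  saturated-next : ∀ {a b} → C (suc a) b ≡ suc a → C a (suc b) ≡ a
  saturated-next {a} {b} sat = ≤-antisym (profile≤row pr a (suc b))
    (≤-pred (≤-trans (≤-trans (≤-reflexive (sym sat)) (Inc⇒≤ (right (suc a) b))) (corner≤ a b)))

  -- Between cells of one kind the increment comes from `C`. Saturation persists to the right, so a
  -- `shifted` cell never follows a saturated one, and a `lower` cell is left only where a = b.
  Slide-right : ∀ {a b x y} → Slide C a b x → Slide C a (suc b) y → Inc x y
  Slide-right (saturated _ _) (saturated _ _) = inj₁ refl
  Slide-right {suc a} {b} (saturated _ sat) (shifted _ C≤a) =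
    contradiction (≤-trans (≤-reflexive (sym sat)) (Inc⇒≤ (right (suc a) b))) (≤⇒≯ C≤a)
  Slide-right (saturated a<b _) (lower b<a) = contradiction b<a (<-asym a<b)
  Slide-right {suc a} {b} (shifted _ _) (saturated _ sat) =
    ≤∧≤suc⇒Inc (m≤n⇒m≤1+n (profile≤row pr a (suc b)))
        (≤-trans (≤-reflexive (sym sat)) (corner≤ a b))
  Slide-right {suc a} {b} (shifted _ _) (shifted _ _) = right a (suc b)
  Slide-right (shifted a<b _) (lower b<a) = contradiction b<a (<-asym a<b)
  Slide-right {suc a} {b} (lower b≤a) (saturated (s≤s a≤b) sat) =
    ≤∧≤suc⇒Inc (≤-trans (m⊓n≤m b _) (m≤n⇒m≤1+n b≤a))
      (s≤s (⊓-glb a≤b (≤-pred (≤-trans (≤-reflexive (sym sat)) (corner≤ a b)))))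
  Slide-right {suc a} {b} (lower b≤a) (shifted (s≤s a≤b) _) =
    ≤∧≤suc⇒Inc (≤-trans (m⊓n≤n b _) (Inc⇒≤ (right a (suc b))))
      (≤-trans (Inc⇒≤suc (right a (suc b)))
          (s≤s (⊓-glb (≤-trans (profile≤row pr a (suc b)) a≤b) ≤-refl)))
  Slide-right {suc a} {b} (lower _) (lower _) = Inc-⊓ (inj₂ refl) (right a (suc b))

  -- Downwards it is the lack of saturation that persists, because values grow by at most 1 per row;
  -- so a saturated cell never follows a `shifted` one.
  Slide-down : ∀ {a b x y} → Slide C a b x → Slide C (suc a) b y → Inc x y
  Slide-down (saturated _ _) (saturated _ _) = inj₂ refl
  Slide-down {a} {b} (saturated _ sat) (shifted _ _) =
    ≤∧≤suc⇒Inc (≤-trans (≤-reflexive (sym sat)) (Inc⇒≤ (right a b)))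
        (m≤n⇒m≤1+n (profile≤row pr a (suc b)))
  Slide-down {a} {b} (saturated a≤b sat) (lower b≤a) =
    ≤∧≤suc⇒Inc (⊓-glb a≤b (≤-trans (≤-reflexive (sym sat)) (Inc⇒≤ (right a b))))
      (≤-trans (m⊓n≤m b _) (m≤n⇒m≤1+n b≤a))
  Slide-down {suc a} {b} (shifted _ C≤a) (saturated _ sat) =
    contradiction (≤-trans (≤-trans (≤-reflexive (sym sat)) (Inc⇒≤suc (down (suc a) b))) (s≤s C≤a))
        (<⇒≱ ≤-refl)
  Slide-down {suc a} {b} (shifted _ _) (shifted _ _) = down a (suc b)
  Slide-down {suc a} {b} (shifted a<b _) (lower _) =
    ≤∧≤suc⇒Inc (⊓-glb (≤-trans (profile≤row pr a (suc b)) (<⇒≤ a<b)) (Inc⇒≤ (down a (suc b))))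
      (≤-trans (m⊓n≤n b _) (Inc⇒≤suc (down a (suc b))))
  Slide-down (lower b≤a) (saturated a<b _) = contradiction b≤a (<⇒≱ (<-trans (n<1+n _) a<b))
  Slide-down (lower b≤a) (shifted a<b _) = contradiction b≤a (<⇒≱ (<-trans (n<1+n _) a<b))
  Slide-down {suc a} {b} (lower _) (lower _) = Inc-⊓ {b} (inj₁ refl) (down a (suc b))

  Slide-rim : ∀ {a b x} → Slide C a b x → n ≤ a ⊎ n ≤ b → x ≡ a ⊓ b
  Slide-rim (saturated a≤b _) out = sym (m≤n⇒m⊓n≡m a≤b)
  Slide-rim {suc a} {b} (shifted a<b C≤a) out =
    contradiction (≤-trans (≤-reflexive (sym (trans (rim (suc a) b out) (m≤n⇒m⊓n≡m a<b)))) C≤a)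
        (<⇒≱ ≤-refl)
  Slide-rim {suc a} {b} (lower b≤a) out = begin
    b ⊓ C a (suc b)  ≡⟨ m≤n⇒m⊓n≡m (≤-pred (≤-trans (≤-reflexive (sym full)) (corner≤ a b))) ⟩
    b                ≡⟨ m≥n⇒m⊓n≡n (m≤n⇒m≤1+n b≤a) ⟨
    suc a ⊓ b        ∎
    where
    open ≡-Reasoning
    -- The next cell to the right is on the rim as well; going up from it loses at most 1, so the
    -- translated value is at least b.
    full : C (suc a) (suc b) ≡ suc b
    full = trans (rim (suc a) (suc b) (Sum.map₂ m≤n⇒m≤1+n out)) (m≥n⇒m⊓n≡n (s≤s b≤a))

  slide-profile : Profile n (slide C)
  slide-profile = record
    { top   = λ b → refl
    ; left  = λ { zero → refl ; (suc a) → refl }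
    ; right = λ a b → Slide-right (slide-view a b) (slide-view a (suc b))
    ; down  = λ a b → Slide-down (slide-view a b) (slide-view (suc a) b)
    ; rim   = λ a b → Slide-rim (slide-view a b)
    }

  module _ (symmetric : ∀ a b → C a b ≡ C b a) where

    -- If the upper cell is not saturated, symmetry shows that the translation exchanges the two
    -- values. If it is, `saturated-next` gives its partner the value a, and both values are kept.
    Slide-pair-< : ∀ {a b x} → a < b → Slide C (suc a) b x →
        x + a ⊓ C b (suc a) ≡ C (suc a) b + C (suc b) a
    Slide-pair-< {a} {b} a<b (saturated _ sat) = cong₂ _+_ (sym sat) (begin
      a ⊓ C b (suc a)
        ≡⟨ m≤n⇒m⊓n≡m (≤-trans (n≤1+n a) (≤-reflexive (trans (sym sat) (symmetric (suc a) b)))) ⟩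
      a                 ≡⟨ saturated-next sat ⟨
      C a (suc b)       ≡⟨ symmetric a (suc b) ⟩
      C (suc b) a       ∎)
      where open ≡-Reasoning
    Slide-pair-< {a} {b} a<b (shifted _ C≤a) = begin
      C a (suc b) + a ⊓ C b (suc a)
        ≡⟨ cong₂ _+_ (symmetric a (suc b)) (cong (a ⊓_) (symmetric b (suc a))) ⟩
      C (suc b) a + a ⊓ C (suc a) b   ≡⟨ cong (λ x → C (suc b) a + x) (m≥n⇒m⊓n≡n C≤a) ⟩
      C (suc b) a + C (suc a) b       ≡⟨ +-comm (C (suc b) a) _ ⟩
      C (suc a) b + C (suc b) a       ∎
      where open ≡-Reasoning
    Slide-pair-< a<b (lower b≤a) = contradiction a<b (≤⇒≯ b≤a)

    Slide-pair : ∀ {a b x y} → Slide C (suc a) b x → Slide C (suc b) a y →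
        x + y ≡ C (suc a) b + C (suc b) a
    -- Both cells lie below the diagonal only if a = b, when the cell is its own partner.
    Slide-pair {a} {b} (lower b≤a) (lower a≤b) = begin
      b ⊓ C a (suc b) + a ⊓ C b (suc a)
        ≡⟨ cong₂ _+_ (m≥n⇒m⊓n≡n (≤-trans (profile≤row pr a (suc b)) a≤b))
            (m≥n⇒m⊓n≡n (≤-trans (profile≤row pr b (suc a)) b≤a)) ⟩
      C a (suc b) + C b (suc a)           ≡⟨ cong₂ _+_ (symmetric a (suc b)) (symmetric b (suc a)) ⟩
      C (suc b) a + C (suc a) b           ≡⟨ +-comm (C (suc b) a) _ ⟩
      C (suc a) b + C (suc b) a           ∎
      where open ≡-Reasoning
    Slide-pair s@(saturated a<b _) (lower _) = Slide-pair-< a<b s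
    Slide-pair s@(shifted a<b _)   (lower _) = Slide-pair-< a<b s
    Slide-pair {a} {b} (lower _) s@(saturated b<a _) =
        trans (+-comm (b ⊓ C a (suc b)) (suc b))
            (trans (Slide-pair-< b<a s) (+-comm (C (suc b) a) (C (suc a) b)))
    Slide-pair {a} {b} (lower _) s@(shifted b<a _)   =
        trans (+-comm (b ⊓ C a (suc b)) (C b (suc a)))
            (trans (Slide-pair-< b<a s) (+-comm (C (suc b) a) (C (suc a) b)))
    Slide-pair (saturated a<b _) (saturated b<a _) = contradiction a<b (<-asym b<a)
    Slide-pair (saturated a<b _) (shifted b<a _)   = contradiction a<b (<-asym b<a)
    Slide-pair (shifted a<b _)   (saturated b<a _) = contradiction a<b (<-asym b<a)
    Slide-pair (shifted a<b _)   (shifted b<a _)   = contradiction a<b (<-asym b<a)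

    -- Without row 0 the reflection becomes the exchange of the two indices. Adding to each cell its
    -- partner doubles the sum, and halving at the end avoids splitting the antidiagonal into pairs.
    layer-slide : ∀ t → layer t (slide C) ≡ layer t C
    layer-slide zero    = sym (top 0)
    layer-slide (suc t) = trans (m+m≡k+k⇒m≡k (begin
      layer t (slide C ∘ suc) + layer t (slide C ∘ suc)             ≡⟨ double (slide C ∘ suc) ⟩
      layer t (λ a b → slide C (suc a) b + slide C (suc b) a)
        ≡⟨ (layer-cong t λ a b _ → Slide-pair (slide-view (suc a) b) (slide-view (suc b) a)) ⟩
      layer t (λ a b → C (suc a) b + C (suc b) a)                   ≡⟨ double (C ∘ suc) ⟨
      layer t (C ∘ suc) + layer t (C ∘ suc)                         ∎)) (sym (layer-down pr t))
      where
      open ≡-Reasoning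
      double : ∀ G → layer t G + layer t G ≡ layer t (λ a b → G a b + G b a)
      double G = trans (cong (λ x → layer t G + x) (sym (layer-flip t G)))
          (sym (layer-+ t G (flip G)))

    module _ (slide-invariant : ∀ a b → slide C a b ≡ C a b) where

      saturated-or-constant : ∀ a b → a < b → C (suc a) b ≡ suc a ⊎ C a (suc b) ≡ C (suc a) b
      saturated-or-constant a b a<b = cases (slide-view (suc a) b) (slide-invariant (suc a) b)
        where
        cases : ∀ {x} → Slide C (suc a) b x → x ≡ C (suc a) b →
            C (suc a) b ≡ suc a ⊎ C a (suc b) ≡ C (suc a) b
        cases (saturated _ sat) _  = inj₁ sat
        cases (shifted _ _)     eq = inj₂ eq
        cases (lower b≤a)       _  = contradiction a<b (≤⇒≯ b≤a)

      -- The middle of an antidiagonal is where truncation by `a ⊓ b` is weakest, so the height is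
      -- read off there.
      central : ℕ → ℕ
      central t = C ⌊ t /2⌋ ⌈ t /2⌉

      central-height : Height central
      central-height = record
        { start = top 0
        -- Up to transposition, the middle of the next antidiagonal is the cell just below the
        -- present middle.
        ; step  = λ t → subst (Inc (central t)) (symmetric (suc ⌊ t /2⌋) ⌈ t /2⌉)
            (down ⌊ t /2⌋ ⌈ t /2⌉)
        ; half  = λ t → ≤-trans
            (+-mono-≤ (profile≤row pr ⌊ t /2⌋ ⌈ t /2⌉) (profile≤col pr ⌊ t /2⌋ ⌈ t /2⌉))
                                (≤-reflexive (⌊n/2⌋+⌈n/2⌉≡n t))
        }

      central-even : ∀ a → central (a + a) ≡ C a a
      central-even a = sym (cong₂ C (n≡⌊n+n/2⌋ a) (n≡⌈n+n/2⌉ a))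

      central-odd : ∀ a → central (a + suc a) ≡ C a (suc a)
      central-odd a = trans (cong central (+-suc a a))
          (sym (cong₂ C (n≡⌈n+n/2⌉ a) (cong suc (n≡⌊n+n/2⌋ a))))

      -- Induction outwards from the middle of the antidiagonal, with b - a growing by 2. If the
      -- inner neighbour is saturated, the value is a and the height is at least a; otherwise the
      -- value is copied, and the inner cap bounds the outer one.
      profile≡cap-above : ∀ d a b → b ≡ d + a → C a b ≡ cap central a b
      profile≡cap-above zero a .a refl =
        ≤-antisym (cap-glb central a a (profile≤row pr a a) (profile≤col pr a a)
            (≤-reflexive (sym (central-even a))))
                  (≤-trans (cap≤height central a a) (≤-reflexive (central-even a)))
      profile≡cap-above (suc zero) a .(suc a) refl =
        ≤-antisym (cap-glb central a (suc a) (profile≤row pr a (suc a))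
            (profile≤col pr a (suc a)) (≤-reflexive (sym (central-odd a))))
                  (≤-trans (cap≤height central a (suc a)) (≤-reflexive (central-odd a)))
      profile≡cap-above (suc (suc d)) a .(suc (suc (d + a))) refl =
          cases (saturated-or-constant a b a<b)
        where
        b : ℕ
        b = suc (d + a)
        a<b : a < b
        a<b = s≤s (m≤n+m a d)
        inner : C (suc a) b ≡ cap central (suc a) b
        inner = profile≡cap-above d (suc a) b (sym (+-suc d a))
        same-layer : central (suc a + b) ≡ central (a + suc b)
        same-layer = cong central (sym (+-suc a b))
        inner≤height : C (suc a) b ≤ central (a + suc b)
        inner≤height = ≤-trans (≤-reflexive inner)
            (≤-trans (cap≤height central (suc a) b) (≤-reflexive same-layer))
        cases : C (suc a) b ≡ suc a ⊎ C a (suc b) ≡ C (suc a) b →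
            C a (suc b) ≡ cap central a (suc b)
        cases (inj₁ sat) = trans (saturated-next sat)
          (≤-antisym (cap-glb central a (suc b) ≤-refl (m≤n⇒m≤1+n (<⇒≤ a<b))
              (≤-trans (≤-trans (n≤1+n a) (≤-reflexive (sym sat))) inner≤height))
                     (cap≤row central a (suc b)))
        cases (inj₂ const) = ≤-antisym
          (cap-glb central a (suc b) (profile≤row pr a (suc b)) (profile≤col pr a (suc b))
              (≤-trans (≤-reflexive const) inner≤height))
          (begin
            cap central a (suc b)
              ≤⟨ cap-glb central (suc a) b
                   (m≤n⇒m≤1+n (cap≤row central a (suc b)))
                   (≤-trans (cap≤row central a (suc b)) (<⇒≤ a<b))
                   (≤-trans (cap≤height central a (suc b)) (≤-reflexive (sym same-layer))) ⟩
            cap central (suc a) b  ≡⟨ inner ⟨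
            C (suc a) b            ≡⟨ const ⟨
            C a (suc b)            ∎)
          where open ≤-Reasoning

      profile≡cap : ∀ a b → C a b ≡ cap central a b
      profile≡cap a b with ≤-total a b
      ... | inj₁ a≤b = profile≡cap-above (b ∸ a) a b (sym (m∸n+n≡m a≤b))
      ... | inj₂ b≤a = begin
        C a b            ≡⟨ symmetric a b ⟩
        C b a            ≡⟨ profile≡cap-above (a ∸ b) b a (sym (m∸n+n≡m b≤a)) ⟩
        cap central b a  ≡⟨ cong₂ (λ m s → m ⊓ central s) (⊓-comm b a) (+-comm b a) ⟩
        cap central a b  ∎
        where open ≡-Reasoning

-- Comparing profiles through their matrices

∂-cong : ∀ {C D} i j →
  C (suc i) (suc j) ≡ D (suc i) (suc j) → C i (suc j) ≡ D i (suc j) →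
      C (suc i) j ≡ D (suc i) j → C i j ≡ D i j →
  ∂ C i j ≡ ∂ D i j
∂-cong i j e₁ e₂ e₃ e₄ =
    cong₂ _-ᶻ_ (cong₂ (λ x y → + x -ᶻ + y) e₁ e₂) (cong₂ (λ x y → + x -ᶻ + y) e₃ e₄)

-- Entries inside the square involve only corner sums with both indices at most n, hence
-- antidiagonals up to 2n.
restrict-∂-cong : ∀ {n C D} → (∀ a b → a + b ≤ n + n → C a b ≡ D a b) →
    restrict n (∂ C) ≋ restrict n (∂ D)
restrict-∂-cong {n} {C} {D} agree r c = ∂-cong {C} {D} (toℕ r) (toℕ c)
  (agree _ _ (+-mono-≤ r< c<)) (agree _ _ (+-mono-≤ (<⇒≤ r<) c<))
  (agree _ _ (+-mono-≤ r< (<⇒≤ c<))) (agree _ _ (+-mono-≤ (<⇒≤ r<) (<⇒≤ c<)))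
  where
  r< : toℕ r < n
  r< = toℕ<n r
  c< : toℕ c < n
  c< = toℕ<n c

-- An entry and three of the corner sums around it give the fourth; outside the square the rim fixes
-- the value.
profile-unique : ∀ {n C D} → Profile n C → Profile n D → restrict n (∂ C) ≋ restrict n (∂ D) →
    ∀ a b → C a b ≡ D a b
profile-unique {n} {C} {D} prC prD same = go
  where
  module C = Profile prC
  module D = Profile prD
  recover : ∀ x y z w → x ≡ ((x -ᶻ y) -ᶻ (z -ᶻ w)) +ᶻ (y +ᶻ (z -ᶻ w))
  recover = solve-∀
  ∂-same : ∀ {i j} → i < n → j < n → ∂ C i j ≡ ∂ D i j
  ∂-same i<n j<n =
      subst₂ (λ i j → ∂ C i j ≡ ∂ D i j) (toℕ-fromℕ< i<n) (toℕ-fromℕ< j<n)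
          (same (fromℕ< i<n) (fromℕ< j<n))
  go : ∀ a b → C a b ≡ D a b
  go zero    b    = trans (C.top b) (sym (D.top b))
  go (suc a) zero = trans (C.left (suc a)) (sym (D.left (suc a)))
  go (suc a) (suc b) with <-≤-connex a n | <-≤-connex b n
  ... | inj₂ n≤a | _        =
      trans (C.rim _ _ (inj₁ (m≤n⇒m≤1+n n≤a))) (sym (D.rim _ _ (inj₁ (m≤n⇒m≤1+n n≤a))))
  ... | inj₁ _   | inj₂ n≤b =
      trans (C.rim (suc a) _ (inj₂ (m≤n⇒m≤1+n n≤b))) (sym (D.rim (suc a) _ (inj₂ (m≤n⇒m≤1+n n≤b))))
  ... | inj₁ a<n | inj₁ b<n = ℤ.+-injective (begin
    + C (suc a) (suc b)
      ≡⟨ recover (+ C (suc a) (suc b)) (+ C a (suc b)) (+ C (suc a) b) (+ C a b) ⟩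
    ∂ C a b +ᶻ (+ C a (suc b) +ᶻ (+ C (suc a) b -ᶻ + C a b))
      ≡⟨ cong₂ _+ᶻ_ (∂-same a<n b<n)
          (cong₂ _+ᶻ_ (cong +_ (go a (suc b))) (cong₂ (λ x y → + x -ᶻ + y) (go (suc a) b) (go a b)))
              ⟩
    ∂ D a b +ᶻ (+ D a (suc b) +ᶻ (+ D (suc a) b -ᶻ + D a b))
        ≡⟨ recover (+ D (suc a) (suc b)) (+ D a (suc b)) (+ D (suc a) b) (+ D a b) ⟨
    + D (suc a) (suc b)                                           ∎)
    where open ≡-Reasoning

-- Profiles and matrix entries given by heights

cap-comm : ∀ f a b → cap f a b ≡ cap f b a
cap-comm f a b = cong₂ (λ m s → m ⊓ f s) (⊓-comm a b) (+-comm a b)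

cap≡row : ∀ f a b → a ≤ b → a ≤ f (a + b) → cap f a b ≡ a
cap≡row f a b a≤b a≤f = ≤-antisym (cap≤row f a b) (cap-glb f a b ≤-refl a≤b a≤f)

cap≡height : ∀ f a b → f (a + b) ≤ a → f (a + b) ≤ b → cap f a b ≡ f (a + b)
cap≡height f a b f≤a f≤b = ≤-antisym (cap≤height f a b) (cap-glb f a b f≤a f≤b ≤-refl)

-- After k steps there are at most n steps E, or at most one more E than S. For a ≥ n the first case
-- gives `b ≤ f (a + b)`; in the second the height is at least half of a + b, rounded down. Either
-- way the height does not truncate.
cap-profile : ∀ {n f} → Height f → (∀ k → k ≤ n + f k ⊎ k ≤ suc (f k + f k)) → Profile n (cap f)
cap-profile {n} {f} ht full = record
  { top   = λ b → refl
  ; left  = λ a → cong (_⊓ f (a + 0)) (⊓-zeroʳ a)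
  ; right = λ a b →
      Inc-⊓ (Inc-⊓ {a} (inj₁ refl) (inj₂ refl))
          (subst (λ s → Inc (f (a + b)) (f s)) (sym (+-suc a b)) (step (a + b)))
  ; down  = λ a b → Inc-⊓ (Inc-⊓ {a} {suc a} {b} (inj₂ refl) (inj₁ refl)) (step (a + b))
  ; rim   = λ { a b (inj₁ n≤a) → rim a b n≤a
              ; a b (inj₂ n≤b) → trans (cap-comm f a b) (trans (rim b a n≤b) (⊓-comm b a)) }
  }
  where
  open Height ht
  rim : ∀ a b → n ≤ a → cap f a b ≡ a ⊓ b
  rim a b n≤a = m≤n⇒m⊓n≡m (bound (full (a + b)))
    where
    bound : a + b ≤ n + f (a + b) ⊎ a + b ≤ suc (f (a + b) + f (a + b)) → a ⊓ b ≤ f (a + b)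
    bound (inj₁ le) =
        ≤-trans (m⊓n≤n a b) (+-cancelˡ-≤ n b (f (a + b)) (≤-trans (+-monoˡ-≤ b n≤a) le))
    bound (inj₂ le) = m+m≤1+k+k⇒m≤k (≤-trans (+-mono-≤ (m⊓n≤m a b) (m⊓n≤n a b)) le)

-- The cell (u , v), counted from 0, of the matrix of a path whose numbers of
-- steps S before, at and after the lattice point on the antidiagonal of the
-- cell are p, q and r.
record Entry (u v p q r : ℕ) (x : ℤ) : Set where
  field
    inner : q ≤ u → q ≤ v → x ≡ (+ r -ᶻ + q) -ᶻ (+ q -ᶻ + p)
    outer : u < q ⊎ v < q → x ≡ 0ℤ

-- One of the two fields always applies and fixes the value, so two matrices agree as soon as both
-- meet this specification.
Entry-unique : ∀ {u v p q r x y} → Entry u v p q r x → Entry u v p q r y → x ≡ y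
Entry-unique {u} {v} {q = q} e e′ with ≤-<-connex q u | ≤-<-connex q v
... | inj₁ q≤u | inj₁ q≤v = trans (Entry.inner e q≤u q≤v) (sym (Entry.inner e′ q≤u q≤v))
... | inj₂ u<q | _        = trans (Entry.outer e (inj₁ u<q)) (sym (Entry.outer e′ (inj₁ u<q)))
... | inj₁ _   | inj₂ v<q = trans (Entry.outer e (inj₂ v<q)) (sym (Entry.outer e′ (inj₂ v<q)))

module _ {f} (ht : Height f) where
  open Height ht

  -- By `half` the hypothesis forces u < v. All four corner sums are then their row numbers, and the
  -- difference in the column direction vanishes.
  ∂-cap-outer : ∀ u v → u < f (suc (u + v)) → ∂ (cap f) u v ≡ 0ℤ
  ∂-cap-outer u v u<q = begin
    ∂ (cap f) u v
      ≡⟨ cong₂ _-ᶻ_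
      (cong₂ (λ x y → + x -ᶻ + y)
        (cap≡row f (suc u) (suc v) (<⇒≤ (s≤s u<v))
            (≤-trans u<q (≤-trans (Inc⇒≤ (step (suc (u + v))))
                (≤-reflexive (cong (f ∘ suc) (sym (+-suc u v)))))))
        (cap≡row f u (suc v) (m≤n⇒m≤1+n (<⇒≤ u<v))
            (≤-trans (<⇒≤ u<q) (≤-reflexive (cong f (sym (+-suc u v)))))))
      (cong₂ (λ x y → + x -ᶻ + y)
        (cap≡row f (suc u) v u<v u<q)
        (cap≡row f u v (<⇒≤ u<v) (≤-pred (≤-trans u<q (Inc⇒≤suc (step (u + v))))))) ⟩
    (+ suc u -ᶻ + u) -ᶻ (+ suc u -ᶻ + u) ≡⟨ ℤ.+-inverseʳ (+ suc u -ᶻ + u) ⟩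
    0ℤ                                 ∎
    where
    open ≡-Reasoning
    u<v : u < v
    u<v with <-≤-connex u v
    ... | inj₁ u<v = u<v
    ... | inj₂ v≤u =
        contradiction (m+m≤1+k+k⇒m≤k (≤-trans (half (suc (u + v))) (s≤s (+-monoʳ-≤ u v≤u))))
            (<⇒≱ u<q)

  ∂-cap-entry : ∀ u v → let t = u + v in
    Entry u v (f t) (f (suc t)) (f (suc (suc t))) (∂ (cap f) u v)
  ∂-cap-entry u v = record { inner = inner ; outer = outer }
    where
    open ≡-Reasoning
    p q r : ℕ
    p = f (u + v)
    q = f (suc (u + v))
    r = f (suc (suc (u + v)))
    at : ∀ a b {t} → a + b ≡ t → f t ≤ a → f t ≤ b → cap f a b ≡ f t
    at a b refl = cap≡height f a b
    -- All four corner sums equal the heights here, so the entry is a second difference of `f`.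
    inner : q ≤ u → q ≤ v → ∂ (cap f) u v ≡ (+ r -ᶻ + q) -ᶻ (+ q -ᶻ + p)
    inner q≤u q≤v = cong₂ _-ᶻ_
      (cong₂ (λ x y → + x -ᶻ + y)
        (at (suc u) (suc v) (cong suc (+-suc u v)) (≤-trans r≤1+q (s≤s q≤u))
            (≤-trans r≤1+q (s≤s q≤v)))
        (at u (suc v) (+-suc u v) q≤u (m≤n⇒m≤1+n q≤v)))
      (cong₂ (λ x y → + x -ᶻ + y)
        (at (suc u) v refl (m≤n⇒m≤1+n q≤u) q≤v)
        (at u v refl (≤-trans p≤q q≤u) (≤-trans p≤q q≤v)))
      where
      p≤q : p ≤ q
      p≤q = Inc⇒≤ (step (u + v))
      r≤1+q : r ≤ suc q
      r≤1+q = Inc⇒≤suc (step (suc (u + v)))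
    outer : u < q ⊎ v < q → ∂ (cap f) u v ≡ 0ℤ
    outer (inj₁ u<q) = ∂-cap-outer u v u<q
    outer (inj₂ v<q) = begin
      ∂ (cap f) u v         ≡⟨ ∂-flip (cap f) u v ⟨
      ∂ (flip (cap f)) v u
        ≡⟨ ∂-cong {flip (cap f)} {cap f} v u (cap-comm f _ _) (cap-comm f _ _)
            (cap-comm f _ _) (cap-comm f _ _) ⟩
      ∂ (cap f) v u         ≡⟨ ∂-cap-outer v u (subst (λ s → v < f (suc s)) (+-comm u v) v<q) ⟩
      0ℤ                    ∎

-- Dyck words

-- A word is continued by alternating steps E and S, which gives cap (height w)
-- the values of a profile outside the square as well.
height : List Step → ℕ → ℕ
height []      k       = ⌊ k /2⌋
height (_ ∷ w) zero    = 0
height (E ∷ w) (suc k) = height w k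
height (S ∷ w) (suc k) = suc (height w k)

height-0 : ∀ w → height w 0 ≡ 0
height-0 []      = refl
height-0 (_ ∷ w) = refl

Inc-⌊/2⌋ : ∀ k → Inc ⌊ k /2⌋ ⌊ suc k /2⌋
Inc-⌊/2⌋ zero          = inj₁ refl
Inc-⌊/2⌋ (suc zero)    = inj₂ refl
Inc-⌊/2⌋ (suc (suc k)) = Sum.map (cong suc) (cong suc) (Inc-⌊/2⌋ k)

height-step : ∀ w t → Inc (height w t) (height w (suc t))
height-step []      t       = Inc-⌊/2⌋ t
height-step (E ∷ w) zero    = inj₁ (height-0 w)
height-step (S ∷ w) zero    = inj₂ (cong suc (height-0 w))
height-step (E ∷ w) (suc t) = height-step w t
height-step (S ∷ w) (suc t) = Sum.map (cong suc) (cong suc) (height-step w t)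

-- i steps S and j steps E have been read before `w`. At the end of the word i ≤ j, and the
-- alternating continuation starts with E.
height-half : ∀ w i j → (∀ k → i + count S (take k w) ≤ j + count E (take k w)) →
              ∀ k → (i + height w k) + (i + height w k) ≤ (i + j) + k
height-half [] i j prefixes k = begin
  (i + ⌊ k /2⌋) + (i + ⌊ k /2⌋)
    ≤⟨ +-mono-≤ (≤-refl {i + ⌊ k /2⌋}) (+-mono-≤ i≤j (⌊n/2⌋≤⌈n/2⌉ k)) ⟩
  (i + ⌊ k /2⌋) + (j + ⌈ k /2⌉)
    ≡⟨ CommutativeSemigroup.interchange +-commutativeSemigroup i ⌊ k /2⌋ j ⌈ k /2⌉ ⟩
  (i + j) + (⌊ k /2⌋ + ⌈ k /2⌉)   ≡⟨ cong (λ x → i + j + x) (⌊n/2⌋+⌈n/2⌉≡n k) ⟩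
  (i + j) + k                     ∎
  where
  open ≤-Reasoning
  i≤j : i ≤ j
  i≤j = subst₂ _≤_ (+-identityʳ i) (+-identityʳ j) (prefixes 0)
height-half (x ∷ w) i j prefixes zero = begin
  (i + 0) + (i + 0)   ≤⟨ +-monoʳ-≤ (i + 0) (prefixes 0) ⟩
  (i + 0) + (j + 0)   ≡⟨ cong₂ _+_ (+-identityʳ i) (+-identityʳ j) ⟩
  i + j               ≡⟨ +-identityʳ (i + j) ⟨
  (i + j) + 0         ∎
  where open ≤-Reasoning
height-half (E ∷ w) i j prefixes (suc k) =
  ≤-trans (height-half w i (suc j) (λ k → ≤-trans (prefixes (suc k)) (≤-reflexive (+-suc j _))) k)
          (≤-reflexive (trans (cong (_+ k) (+-suc i j)) (sym (+-suc (i + j) k))))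
height-half (S ∷ w) i j prefixes (suc k) = begin
  (i + suc (height w k)) + (i + suc (height w k))   ≡⟨ cong₂ _+_ (+-suc i _) (+-suc i _) ⟩
  (suc i + height w k) + (suc i + height w k)
    ≤⟨ height-half w (suc i) j
        (λ k → ≤-trans (≤-reflexive (sym (+-suc i _))) (prefixes (suc k))) k ⟩
  (suc i + j) + k                                   ≡⟨ +-suc (i + j) k ⟨
  (i + j) + suc k                                   ∎
  where open ≤-Reasoning

-- Within the word at most n steps E have been read. At its end i = j, and the continuation is at
-- most one E ahead.
height-full : ∀ {n} w i j → j + count E w ≡ n → i + count S w ≡ n → ∀ k →
  let h = i + height w k in (i + j) + k ≤ n + h ⊎ (i + j) + k ≤ suc (h + h)
height-full {n} [] i j nE nS k = inj₂ (begin
  (i + j) + k                             ≡⟨ cong₂ (λ x y → i + x + y) j≡i (sym (⌊n/2⌋+⌈n/2⌉≡n k)) ⟩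
  (i + i) + (⌊ k /2⌋ + ⌈ k /2⌉)
    ≡⟨ CommutativeSemigroup.interchange +-commutativeSemigroup i i ⌊ k /2⌋ ⌈ k /2⌉ ⟩
  (i + ⌊ k /2⌋) + (i + ⌈ k /2⌉)
    ≤⟨ +-monoʳ-≤ (i + ⌊ k /2⌋) (+-monoʳ-≤ i (Inc⇒≤suc (Inc-⌊/2⌋ k))) ⟩
  (i + ⌊ k /2⌋) + (i + suc ⌊ k /2⌋)
    ≡⟨ trans (cong (λ x → i + ⌊ k /2⌋ + x) (+-suc i _)) (+-suc (i + ⌊ k /2⌋) _) ⟩
  suc ((i + ⌊ k /2⌋) + (i + ⌊ k /2⌋))     ∎)
  where
  open ≤-Reasoning
  j≡i : j ≡ i
  j≡i = +-cancelʳ-≡ 0 j i (trans nE (sym nS))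
height-full {n} (x ∷ w) i j nE nS zero = inj₁ (begin
  (i + j) + 0                  ≡⟨ trans (+-identityʳ (i + j)) (+-comm i j) ⟩
  j + i
    ≤⟨ +-monoˡ-≤ i (≤-trans (m≤m+n j (count E (x ∷ w))) (≤-reflexive nE)) ⟩
  n + i                        ≡⟨ cong (λ x → n + x) (+-identityʳ i) ⟨
  n + (i + 0)                  ∎)
  where open ≤-Reasoning
height-full {n} (E ∷ w) i j nE nS (suc k) =
  subst (λ s → s ≤ n + (i + height w k) ⊎ s ≤ suc ((i + height w k) + (i + height w k)))
        (trans (cong (_+ k) (+-suc i j)) (sym (+-suc (i + j) k)))
        (height-full w i (suc j) (trans (sym (+-suc j _)) nE) nS k)
height-full {n} (S ∷ w) i j nE nS (suc k) =
  subst₂ (λ s h → s ≤ n + h ⊎ s ≤ suc (h + h)) (sym (+-suc (i + j) k)) (sym (+-suc i (height w k)))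
         (height-full w (suc i) j nE (trans (sym (+-suc i _)) nS) k)

-- Peaks and valleys as second differences of heights

mark : List (ℕ × ℕ) → List (ℕ × ℕ) → ℕ → ℕ → ℤ
mark ps vs a b =
  if does (any? (between? a b) ps) then 1ℤ else
  if does (any? (between? a b) vs) then -1ℤ else
  0ℤ

module _ (u v : ℕ) where

  hit : List (ℕ × ℕ) → Bool
  hit ps = does (any? (between? (suc u) (suc v)) ps)

  off-layer : ∀ i j → suc (u + v) ≢ i + j → does (between? (suc u) (suc v) (i , j)) ≡ false
  off-layer i j neq = dec-false (between? (suc u) (suc v) (i , j)) λ (eq , _) →
    neq (suc-injective (trans (cong suc (sym (+-suc u v))) (trans eq (+-comm (i + j) 1))))

  -- The coordinates of a peak still to come add up to more than u + v + 1, the sum required by the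
  -- cell.
  peaks-beyond : ∀ w i j → u + v < i + j → hit (peaksFrom i j w) ≡ false
  peaks-beyond []          i j lt = refl
  peaks-beyond (E ∷ [])    i j lt = refl
  peaks-beyond (E ∷ E ∷ w) i j lt =
      peaks-beyond (E ∷ w) i (suc j) (<-≤-trans lt (+-monoʳ-≤ i (n≤1+n j)))
  peaks-beyond (E ∷ S ∷ w) i j lt =
    cong₂ _∨_ (off-layer i (suc j) λ eq → <⇒≢ lt (suc-injective (trans eq (+-suc i j))))
              (peaks-beyond (S ∷ w) i (suc j) (<-≤-trans lt (+-monoʳ-≤ i (n≤1+n j))))
  peaks-beyond (S ∷ w)     i j lt = peaks-beyond w (suc i) j (m<n⇒m<1+n lt)

  valleys-beyond : ∀ w i j → u + v < i + j → hit (valleysFrom i j w) ≡ false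
  valleys-beyond []          i j lt = refl
  valleys-beyond (S ∷ [])    i j lt = refl
  valleys-beyond (S ∷ S ∷ w) i j lt = valleys-beyond (S ∷ w) (suc i) j (m<n⇒m<1+n lt)
  valleys-beyond (S ∷ E ∷ w) i j lt =
    cong₂ _∨_ (off-layer (suc i) j λ eq → <⇒≢ lt (suc-injective eq))
              (valleys-beyond (E ∷ w) (suc i) j (m<n⇒m<1+n lt))
  valleys-beyond (E ∷ w)     i j lt =
      valleys-beyond w i (suc j) (<-≤-trans lt (+-monoʳ-≤ i (n≤1+n j)))

  markFrom : ℕ → ℕ → List Step → ℤ
  markFrom i j w = mark (peaksFrom i j w) (valleysFrom i j w) (suc u) (suc v)

  choose : Bool → Bool → ℤ
  choose p v = if p then 1ℤ else if v then -1ℤ else 0ℤ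

  markFrom-E : ∀ i j w → i + j < u + v → markFrom i j (E ∷ w) ≡ markFrom i (suc j) w
  markFrom-E i j []      lt = refl
  markFrom-E i j (E ∷ w) lt = refl
  markFrom-E i j (S ∷ w) lt =
    cong (λ p → choose (p ∨ hit (peaksFrom i (suc j) (S ∷ w)))
        (hit (valleysFrom i (suc j) (S ∷ w))))
         (off-layer i (suc j) λ eq → >⇒≢ lt (suc-injective (trans eq (+-suc i j))))

  markFrom-S : ∀ i j w → i + j < u + v → markFrom i j (S ∷ w) ≡ markFrom (suc i) j w
  markFrom-S i j []      lt = refl
  markFrom-S i j (S ∷ w) lt = refl
  markFrom-S i j (E ∷ w) lt =
    cong (λ p → choose (hit (peaksFrom (suc i) j (E ∷ w)))
        (p ∨ hit (valleysFrom (suc i) j (E ∷ w))))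
         (off-layer (suc i) j λ eq → >⇒≢ lt (suc-injective eq))

  -- Since u + v + 1 = i + j, the condition i ≤ v is u + 1 ≤ j in disguise.
  Between-inner : ∀ i j → suc (u + v) ≡ i + j → i ≤ u → i ≤ v → Between (suc u) (suc v) (i , j)
  Between-inner i j eq i≤u i≤v =
    trans (cong suc (+-suc u v)) (trans (cong suc eq) (+-comm 1 (i + j))) ,
    ≤-trans (≤-reflexive (+-comm i 1)) (s≤s i≤u) ,
    +-cancelˡ-≤ i (suc u) j (begin
      i + suc u   ≡⟨ +-suc i u ⟩
      suc (i + u) ≤⟨ s≤s (+-monoˡ-≤ u i≤v) ⟩
      suc (v + u) ≡⟨ cong suc (+-comm v u) ⟩
      suc (u + v) ≡⟨ eq ⟩
      i + j       ∎)
    where open ≤-Reasoning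

  Between-outer : ∀ i j → suc (u + v) ≡ i + j → u < i ⊎ v < i → ¬ Between (suc u) (suc v) (i , j)
  Between-outer i j eq (inj₁ u<i) (_ , i<a , _) =
      <⇒≱ u<i (≤-pred (≤-trans (≤-reflexive (+-comm 1 i)) i<a))
  Between-outer i j eq (inj₂ v<i) (_ , _ , u<j) = <⇒≢ (begin-strict
    suc (u + v) ≡⟨ +-suc u v ⟨
    u + suc v   <⟨ +-mono-<-≤ u<j v<i ⟩
    j + i       ≡⟨ +-comm j i ⟩
    i + j       ∎) eq
    where open ≤-Reasoning

  module _ {i j} (u+v≡i+j : u + v ≡ i + j) where

    after-E : u + v < i + suc j
    after-E = ≤-reflexive (trans (cong suc u+v≡i+j) (sym (+-suc i j)))

    after-S : u + v < suc i + j
    after-S = ≤-reflexive (cong suc u+v≡i+j)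

    on-peak : suc (u + v) ≡ i + suc j
    on-peak = trans (cong suc u+v≡i+j) (sym (+-suc i j))

    on-valley : suc (u + v) ≡ suc i + j
    on-valley = cong suc u+v≡i+j

    -- Here and in the next three lemmas the two letters around the antidiagonal decide. Equal
    -- letters have second difference 0, `E S` has 1 as at a peak, and `S E` has -1 as at a valley.
    -- The middle height is the number of steps S at the lattice point.
    markFrom-EE : ∀ w → Entry u v i i i (markFrom i j (E ∷ E ∷ w))
    markFrom-EE w = record
      { inner = λ _ _ → trans blank (sym (ℤ.+-inverseʳ (+ i -ᶻ + i)))
      ; outer = λ _ → blank }
      where
      blank : markFrom i j (E ∷ E ∷ w) ≡ 0ℤ
      blank = cong₂ choose (peaks-beyond (E ∷ w) i (suc j) after-E)
          (valleys-beyond (E ∷ w) i (suc j) after-E)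

    markFrom-SS : ∀ w → Entry u v i (suc i) (suc (suc i)) (markFrom i j (S ∷ S ∷ w))
    markFrom-SS w = record
      { inner = λ _ _ → trans blank (sym (cong₂ _-ᶻ_ (suc-⊖ (suc i)) (suc-⊖ i)))
      ; outer = λ _ → blank }
      where
      blank : markFrom i j (S ∷ S ∷ w) ≡ 0ℤ
      blank = cong₂ choose (peaks-beyond (S ∷ w) (suc i) j after-S)
          (valleys-beyond (S ∷ w) (suc i) j after-S)

    markFrom-ES : ∀ w → Entry u v i i (suc i) (markFrom i j (E ∷ S ∷ w))
    markFrom-ES w = record
      { inner = λ i≤u i≤v → trans
          (cong (λ p → choose (p ∨ hit (peaksFrom i (suc j) (S ∷ w)))
              (hit (valleysFrom i (suc j) (S ∷ w))))
                (dec-true (between? (suc u) (suc v) (i , suc j))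
                    (Between-inner i (suc j) on-peak i≤u i≤v)))
          (sym (cong₂ _-ᶻ_ (suc-⊖ i) (ℤ.+-inverseʳ (+ i))))
      ; outer = λ out → cong₂ choose
          (cong₂ _∨_ (dec-false (between? (suc u) (suc v) (i , suc j))
              (Between-outer i (suc j) on-peak out))
                     (peaks-beyond (S ∷ w) i (suc j) after-E))
          (valleys-beyond (S ∷ w) i (suc j) after-E) }

    markFrom-SE : ∀ w → Entry u v i (suc i) (suc i) (markFrom i j (S ∷ E ∷ w))
    markFrom-SE w = record
      { inner = λ i<u i<v → trans
          (cong₂ (λ p v → choose p (v ∨ hit (valleysFrom (suc i) j (E ∷ w))))
                (peaks-beyond (E ∷ w) (suc i) j after-S)
                (dec-true (between? (suc u) (suc v) (suc i , j))
                    (Between-inner (suc i) j on-valley i<u i<v)))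
          (sym (cong₂ _-ᶻ_ (ℤ.+-inverseʳ (+ suc i)) (suc-⊖ i)))
      ; outer = λ out → cong₂ choose
          (peaks-beyond (E ∷ w) (suc i) j after-S)
          (cong₂ _∨_ (dec-false (between? (suc u) (suc v) (suc i , j))
              (Between-outer (suc i) j on-valley out))
                     (valleys-beyond (E ∷ w) (suc i) j after-S)) }

  Entry-resp : ∀ {p q r p′ q′ r′ x} → p ≡ p′ → q ≡ q′ → r ≡ r′ → Entry u v p′ q′ r′ x →
      Entry u v p q r x
  Entry-resp refl refl refl e = e

  -- m letters are skipped before the antidiagonal of the cell is reached; two more must remain to
  -- be inspected.
  markFrom-entry : ∀ m w i j → u + v ≡ i + j + m → suc (suc m) ≤ length w →
    Entry u v (i + height w m) (i + height w (suc m)) (i + height w (suc (suc m))) (markFrom i j w)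
  markFrom-entry (suc m) (x ∷ w) i j eq (s≤s len) = first x
    where
    later : i + j < u + v
    later = ≤-trans (s≤s (m≤m+n (i + j) m)) (≤-reflexive (sym (trans eq (+-suc (i + j) m))))
    first : ∀ x → let h = height (x ∷ w) in
      Entry u v (i + h (suc m)) (i + h (suc (suc m))) (i + h (suc (suc (suc m))))
          (markFrom i j (x ∷ w))
    first E = subst (Entry u v _ _ _) (sym (markFrom-E i j w later))
      (markFrom-entry m w i (suc j)
          (trans eq (trans (+-suc (i + j) m) (cong (_+ m) (sym (+-suc i j))))) len)
    first S = subst (Entry u v _ _ _) (sym (markFrom-S i j w later))
      (Entry-resp (+-suc i _) (+-suc i _) (+-suc i _)
        (markFrom-entry m w (suc i) j (trans eq (+-suc (i + j) m)) len))
  markFrom-entry zero (x ∷ y ∷ w) i j eq (s≤s (s≤s _)) = first x y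
    where
    on-layer : u + v ≡ i + j
    on-layer = trans eq (+-identityʳ (i + j))
    +0 : ∀ {h} → h ≡ 0 → i + h ≡ i
    +0 refl = +-identityʳ i
    +1 : ∀ {h} → h ≡ 0 → i + suc h ≡ suc i
    +1 refl = +-comm i 1
    +2 : ∀ {h} → h ≡ 0 → i + suc (suc h) ≡ suc (suc i)
    +2 refl = +-comm i 2
    first : ∀ x y → let h = height (x ∷ y ∷ w) in
      Entry u v (i + 0) (i + h 1) (i + h 2) (markFrom i j (x ∷ y ∷ w))
    first E E = Entry-resp (+0 refl) (+0 refl) (+0 (height-0 w)) (markFrom-EE on-layer w)
    first S S = Entry-resp (+0 refl) (+1 refl) (+2 (height-0 w)) (markFrom-SS on-layer w)
    first E S = Entry-resp (+0 refl) (+0 refl) (+1 (height-0 w)) (markFrom-ES on-layer w)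
    first S E = Entry-resp (+0 refl) (+1 refl) (+1 (height-0 w)) (markFrom-SE on-layer w)

count-E+count-S : ∀ w → count E w + count S w ≡ length w
count-E+count-S []      = refl
count-E+count-S (E ∷ w) = cong suc (count-E+count-S w)
count-E+count-S (S ∷ w) = trans (+-suc (count E w) (count S w)) (cong suc (count-E+count-S w))

≋-sym : ∀ {n} {A B : Matrix n} → A ≋ B → B ≋ A
≋-sym A≋B r c = sym (A≋B r c)

≋-trans : ∀ {n} {A B C : Matrix n} → A ≋ B → B ≋ C → A ≋ C
≋-trans A≋B B≋C r c = trans (A≋B r c) (B≋C r c)

-- The matrix of a Dyck path is determined by its X-ray

module _ {n} (D : DyckPath n) where

  heights : ℕ → ℕ
  heights = height (word D)

  heights-height : Height heights
  heights-height = record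
    { start = height-0 (word D)
    ; step  = height-step (word D)
    ; half  = height-half (word D) 0 0 (prefixes D)
    }

  heights-profile : Profile n (cap heights)
  heights-profile = cap-profile heights-height (height-full (word D) 0 0 (count-E D) (count-S D))

  word-length : length (word D) ≡ n + n
  word-length = trans (sym (count-E+count-S (word D))) (cong₂ _+_ (count-E D) (count-S D))

  𝒜≋∂-cap : 𝒜 D ≋ restrict n (∂ (cap heights))
  𝒜≋∂-cap r c = Entry-unique
    (markFrom-entry u v (u + v) (word D) 0 0 refl
      -- The letters inspected are those numbered u + v + 1 and u + v + 2; u, v < n keeps them
      -- within the length 2n.
      (≤-trans (≤-reflexive (cong suc (sym (+-suc u v))))
          (≤-trans (+-mono-≤ (toℕ<n r) (toℕ<n c)) (≤-reflexive (sym word-length)))))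
    (∂-cap-entry heights-height u v)
    where
    u v : ℕ
    u = toℕ r
    v = toℕ c

  𝒜-isASM : IsASM (𝒜 D)
  𝒜-isASM = IsASM-resp-≋ (≋-sym 𝒜≋∂-cap) (restrict-∂-isASM heights-profile)

  𝒜-determined : DeterminedByXray (𝒜 D)
  𝒜-determined B asmB same =
      ≋-trans (≋-sym (restrict-∂-corner asmB))
          (≋-trans (≋-sym (restrict-∂-cong agree)) (≋-sym 𝒜≋∂-cap))
    where
    same-layers : ∀ t → t ≤ 2 * n → layer t (cap heights) ≡ layer t (corner B)
    same-layers = layers-determined-by-xray heights-profile (corner-profile asmB) λ k → begin
      xray (restrict n (∂ (cap heights))) k   ≡⟨ xray-cong 𝒜≋∂-cap k ⟨
      xray (𝒜 D) k                            ≡⟨ same k ⟨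
      xray B k                                ≡⟨ xray-cong (restrict-∂-corner asmB) k ⟨
      xray (restrict n (∂ (corner B))) k      ∎
      where open ≡-Reasoning
    agree : ∀ a b → a + b ≤ n + n → cap heights a b ≡ corner B a b
    agree a b a+b≤ =
        layers-determine-cap (corner-profile asmB) heights-height (2 * n) same-layers (a + b)
      (≤-trans a+b≤ (≤-reflexive (cong (λ x → n + x) (sym (+-identityʳ n))))) a b refl

-- Injectivity

-- By `half` the truncation is inactive in the middle of an antidiagonal, so heights can be
-- recovered from corner sums.
cap-central : ∀ {f} → Height f → ∀ t → cap f ⌊ t /2⌋ ⌈ t /2⌉ ≡ f t
cap-central {f} ht t =
    trans (cap≡height f ⌊ t /2⌋ ⌈ t /2⌉ bound (≤-trans bound (⌊n/2⌋≤⌈n/2⌉ t)))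
        (cong f (⌊n/2⌋+⌈n/2⌉≡n t))
  where
  open ≤-Reasoning
  bound : f (⌊ t /2⌋ + ⌈ t /2⌉) ≤ ⌊ t /2⌋
  bound = m+m≤1+k+k⇒m≤k (begin
    f (⌊ t /2⌋ + ⌈ t /2⌉) + f (⌊ t /2⌋ + ⌈ t /2⌉)   ≤⟨ Height.half ht (⌊ t /2⌋ + ⌈ t /2⌉) ⟩
    ⌊ t /2⌋ + ⌈ t /2⌉                               ≤⟨ +-monoʳ-≤ ⌊ t /2⌋ (Inc⇒≤suc (Inc-⌊/2⌋ t)) ⟩
    ⌊ t /2⌋ + suc ⌊ t /2⌋                           ≡⟨ +-suc ⌊ t /2⌋ ⌊ t /2⌋ ⟩
    suc (⌊ t /2⌋ + ⌊ t /2⌋)                         ∎)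

height-injective : ∀ w w′ → length w ≡ length w′ → (∀ t → height w t ≡ height w′ t) → w ≡ w′
height-injective []      []       _   _  = refl
height-injective (E ∷ w) (E ∷ w′) len eq =
    cong (E ∷_) (height-injective w w′ (suc-injective len) (eq ∘ suc))
height-injective (S ∷ w) (S ∷ w′) len eq =
    cong (S ∷_) (height-injective w w′ (suc-injective len) (suc-injective ∘ eq ∘ suc))
height-injective (E ∷ w) (S ∷ w′) len eq = contradiction (trans (sym (height-0 w)) (eq 1)) λ ()
height-injective (S ∷ w) (E ∷ w′) len eq =
    contradiction (trans (sym (height-0 w′)) (sym (eq 1))) λ ()

𝒜-injective : ∀ {n} (D D′ : DyckPath n) → 𝒜 D ≋ 𝒜 D′ → word D ≡ word D′
𝒜-injective D D′ 𝒜≋ =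
    height-injective (word D) (word D′) (trans (word-length D) (sym (word-length D′))) λ t → begin
  heights D t                        ≡⟨ cap-central (heights-height D) t ⟨
  cap (heights D) ⌊ t /2⌋ ⌈ t /2⌉    ≡⟨ same-cap ⌊ t /2⌋ ⌈ t /2⌉ ⟩
  cap (heights D′) ⌊ t /2⌋ ⌈ t /2⌉   ≡⟨ cap-central (heights-height D′) t ⟩
  heights D′ t                       ∎
  where
  open ≡-Reasoning
  same-cap : ∀ a b → cap (heights D) a b ≡ cap (heights D′) a b
  same-cap = profile-unique (heights-profile D) (heights-profile D′)
    (≋-trans (≋-sym (𝒜≋∂-cap D)) (≋-trans 𝒜≋ (𝒜≋∂-cap D′)))

-- Dyck paths from heights

module _ {f} (ht : Height f) where
  open Height ht

  letter : ∀ {m k} → Inc m k → Step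
  letter (inj₁ _) = E
  letter (inj₂ _) = S

  wordFrom : ℕ → ℕ → List Step
  wordFrom t zero    = []
  wordFrom t (suc k) = letter (step t) ∷ wordFrom (suc t) k

  length-wordFrom : ∀ t k → length (wordFrom t k) ≡ k
  length-wordFrom t zero    = refl
  length-wordFrom t (suc k) = cong suc (length-wordFrom (suc t) k)

  -- Prefixes have the same form as the whole word, which reduces the prefix condition to `half`.
  take-wordFrom : ∀ t k m → take m (wordFrom t k) ≡ wordFrom t (m ⊓ k)
  take-wordFrom t k       zero    = refl
  take-wordFrom t zero    (suc m) = refl
  take-wordFrom t (suc k) (suc m) = cong (letter (step t) ∷_) (take-wordFrom (suc t) k m)

  count-S-wordFrom : ∀ t k → f t + count S (wordFrom t k) ≡ f (t + k)
  count-S-wordFrom t zero    = trans (+-identityʳ (f t)) (cong f (sym (+-identityʳ t)))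
  count-S-wordFrom t (suc k) with step t | count-S-wordFrom (suc t) k
  ... | inj₁ level | ih =
      trans (cong (_+ count S (wordFrom (suc t) k)) (sym level))
          (trans ih (cong f (sym (+-suc t k))))
  ... | inj₂ rise  | ih =
      trans (+-suc (f t) _)
          (trans (cong (_+ count S (wordFrom (suc t) k)) (sym rise))
              (trans ih (cong f (sym (+-suc t k)))))

  height-wordFrom : ∀ t k m → m ≤ k → f t + height (wordFrom t k) m ≡ f (t + m)
  height-wordFrom t k       zero    m≤k =
      trans (cong (λ x → f t + x) (height-0 (wordFrom t k)))
          (trans (+-identityʳ (f t)) (cong f (sym (+-identityʳ t))))
  height-wordFrom t (suc k) (suc m) (s≤s m≤k) with step t | height-wordFrom (suc t) k m m≤k
  ... | inj₁ level | ih =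
      trans (cong (_+ height (wordFrom (suc t) k) m) (sym level))
          (trans ih (cong f (sym (+-suc t m))))
  ... | inj₂ rise  | ih =
      trans (+-suc (f t) _)
          (trans (cong (_+ height (wordFrom (suc t) k) m) (sym rise))
              (trans ih (cong f (sym (+-suc t m)))))

  count-S-prefix : ∀ k → count S (wordFrom 0 k) ≡ f k
  count-S-prefix k = trans (cong (_+ count S (wordFrom 0 k)) (sym start)) (count-S-wordFrom 0 k)

  count-E-prefix : ∀ k → count E (wordFrom 0 k) + f k ≡ k
  count-E-prefix k = trans (cong (λ x → count E (wordFrom 0 k) + x) (sym (count-S-prefix k)))
    (trans (count-E+count-S (wordFrom 0 k)) (length-wordFrom 0 k))

  pathOf : ∀ {n} → f (n + n) ≡ n → DyckPath n
  pathOf {n} end = record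
    { word     = wordFrom 0 (n + n)
    ; count-E  = +-cancelʳ-≡ n _ n
        (trans (cong (λ x → count E (wordFrom 0 (n + n)) + x) (sym end)) (count-E-prefix (n + n)))
    ; count-S  = trans (count-S-prefix (n + n)) end
    ; prefixes = λ k →
        subst (λ w → count S w ≤ count E w) (sym (take-wordFrom 0 (n + n) k))
            (balanced (k ⊓ (n + n)))
    }
    where
    balanced : ∀ k → count S (wordFrom 0 k) ≤ count E (wordFrom 0 k)
    balanced k = ≤-trans (≤-reflexive (count-S-prefix k))
      (+-cancelʳ-≤ (f k) (f k) _ (≤-trans (half k) (≤-reflexive (sym (count-E-prefix k)))))

  -- The bound is the length of the word: beyond it `height` continues by alternating steps and may
  -- differ from `f`.
  heights-pathOf : ∀ {n} (end : f (n + n) ≡ n) t → t ≤ n + n → heights (pathOf end) t ≡ f t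
  heights-pathOf {n} end t t≤ =
      trans (cong (_+ heights (pathOf end) t) (sym start)) (height-wordFrom 0 (n + n) t t≤)

-- Surjectivity

module _ {n} {A : Matrix n} (asm : IsASM A) (determined : DeterminedByXray A) where

  -- A profile with the same antidiagonal sums yields an alternating sign matrix with the X-ray of
  -- `A`, hence `A` itself. Transposition and translation both enter through this.
  corner-rigid : ∀ {C} → Profile n C → (∀ t → layer t C ≡ layer t (corner A)) →
      ∀ a b → C a b ≡ corner A a b
  corner-rigid {C} pr same = profile-unique pr (corner-profile asm) (≋-trans
    (determined (restrict n (∂ C)) (restrict-∂-isASM pr) λ k →
      trans (xray-determined-by-layers pr (corner-profile asm) same k)
          (xray-cong (restrict-∂-corner asm) k))
    (≋-sym (restrict-∂-corner asm)))

  corner-symmetric : ∀ a b → corner A a b ≡ corner A b a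
  corner-symmetric a b =
      corner-rigid (Profile-flip (corner-profile asm)) (λ t → layer-flip t (corner A)) b a

  corner-slide : ∀ a b → slide (corner A) a b ≡ corner A a b
  corner-slide = corner-rigid (slide-profile (corner-profile asm))
      (layer-slide (corner-profile asm) corner-symmetric)

  profile : ℕ → ℕ
  profile = central (corner-profile asm) corner-symmetric corner-slide

  profile-height : Height profile
  profile-height = central-height (corner-profile asm) corner-symmetric corner-slide

  profile-end : profile (n + n) ≡ n
  profile-end = begin
    profile (n + n)  ≡⟨ central-even (corner-profile asm) corner-symmetric corner-slide n ⟩
    corner A n n     ≡⟨ Profile.rim (corner-profile asm) n n (inj₁ ≤-refl) ⟩
    n ⊓ n            ≡⟨ ⊓-idem n ⟩
    n                ∎
    where open ≡-Reasoning

  path : DyckPath n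
  path = pathOf profile-height profile-end

  𝒜-path : 𝒜 path ≋ A
  𝒜-path = ≋-trans (𝒜≋∂-cap path) (≋-trans (restrict-∂-cong agree) (restrict-∂-corner asm))
    where
    agree : ∀ a b → a + b ≤ n + n → cap (heights path) a b ≡ corner A a b
    agree a b a+b≤ =
        trans (cong (λ x → a ⊓ b ⊓ x) (heights-pathOf profile-height profile-end (a + b) a+b≤))
      (sym (profile≡cap (corner-profile asm) corner-symmetric corner-slide a b))

𝒜-cong : ∀ {n} (D D′ : DyckPath n) → word D ≡ word D′ → 𝒜 D ≋ 𝒜 D′
𝒜-cong D D′ eq r c = cong (λ w → mark (peaks w) (valleys w) (num r) (num c)) eq

theorem1p1 : (n : ℕ) → 1 ≤ n →
    Σ ((D : DyckPath n) → IsASM (𝒜 D) × DeterminedByXray (𝒜 D)) λ determined →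
    IsBijection (_≈ᴰ_ {n}) (_≈ᴬ_ {n}) (λ D → 𝒜 D , determined D)
theorem1p1 n _ = (λ D → 𝒜-isASM D , 𝒜-determined D) , record
  { isInjection = record
    { isCongruent = record
      { cong           = λ {D} {D′} → 𝒜-cong D D′
      ; isEquivalence₁ = record { refl = refl ; sym = sym ; trans = trans }
      ; isEquivalence₂ = record
        { refl  = λ _ _ → refl
        ; sym   = ≋-sym
        ; trans = ≋-trans
        }
      }
    ; injective = λ {D} {D′} → 𝒜-injective D D′
    }
  ; surjective = λ (A , asm , determined) → path asm determined ,
      -- Surjectivity quantifies over every path equal to the chosen preimage, whence the first
      -- link.
      λ {D} eq → ≋-trans (𝒜-cong D (path asm determined) eq) (𝒜-path asm determined)
  }
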